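{- Let $n = p_1^{\alpha_1}\cdots p_r^{\alpha_r}$ be the prime factorisation of a positive integer $n$ (distinct primes, $\alpha_j>0$). Then the set of primes dividing at least one diagonal entry of the diagonal matrix $\bigotimes_{j=1}^r S(A_{p_j^{\alpha_j}})$ (Kronecker product) is $\{p_1,\dots,p_r\}$, and for each $j$ the weakly decreasing rearrangement of the exponents of $p_j$ in the $n$ diagonal entries consists of the value $\alpha_j - i$ repeated $\phi(p_j^i)\, n / p_j^{\alpha_j}$ times, for $0 \le i \le \alpha_j$.
   Context: For a positive integer $k$, let $\Phi_d$ denote the $d$th cyclotomic polynomial and let $\Psi_k : \mathbf{Z}[X]/(X^k-1) \to \bigoplus_{d \mid k} \mathbf{Z}[X]/(\Phi_d(X))$ be the natural map $f \bmod (X^k-1) \mapsto \bigoplus_{d\mid k} f \bmod \Phi_d(X)$, with bases $(1,\overline{X},\dots,\overline{X}^{k-1})$ on the domain, $(1,\overline{X},\dots,\overline{X}^{\phi(d)-1})$ on each summand, summands ordered by increasing $d$; $A_k$ is the matrix of $\Psi_k$ in these bases. $S(A)$ denotes the Smith normal form of an integer matrix $A$ with non-negative diagonal entries. $\phi$ is Euler's totient function. -}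

module Defs where

open import Algebra.Properties.Semiring.Sum using (sum)
open import Data.Bool.Base using (if_then_else_)
open import Data.Fin.Base using (Fin; zero; suc; toℕ; remQuot)
open import Data.Fin.Properties using () renaming (_≟_ to _≟ᶠ_)
open import Data.Integer.Base using (ℤ; 0ℤ; 1ℤ; -1ℤ; +_; -_; _+_; _*_) renaming (_≤_ to _≤ᶻ_)
open import Data.Integer.Divisibility using () renaming (_∣_ to _∣ᶻ_)
open import Data.Integer.Properties using (+-*-semiring; *-zeroʳ) renaming (_≟_ to _≟ᶻ_)
open import Data.Integer.Tactic.RingSolver using (solve-∀)
open import Data.List.Base using (List; []; _∷_; _++_; map; foldr; filter; length; lookup; replicate; concatMap; upTo; applyUpTo)
open import Data.List.Properties using (map-cong-local)
open import Data.List.Relation.Binary.Permutation.Propositional using (_↭_)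
open import Data.List.Relation.Unary.All as All using (All; all?)
open import Data.List.Relation.Unary.All.Properties using (applyUpTo⁺₁; filter⁺)
open import Data.List.Relation.Unary.Linked using (Linked)
open import Data.Nat.Base as ℕ using (ℕ; zero; suc; _^_; _∸_; _≤_; _≥_; z≤n; s≤s; NonZero)
open import Data.Nat.Coprimality using (coprime?)
open import Data.Nat.Divisibility using (_∣?_)
open import Data.Nat.DivMod using (_/_)
open import Data.Nat.Properties using (m^n≢0; ≤-refl; ≤-trans)
open import Data.Product.Base using (_×_; _,_; proj₁; proj₂; ∃-syntax)
open import Data.Vec.Functional using (Vector) renaming (foldr to foldrᵛ)
open import Relation.Binary.PropositionalEquality using (_≡_; _≢_; refl; cong; module ≡-Reasoning)
open import Relation.Nullary.Decidable using (does)
open import Relation.Nullary.Negation using (¬_)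

-- Polynomials over ℤ are coefficient lists, constant term first.  Trailing
-- zeros are allowed, so a polynomial is determined by its `coeff` function.

ℤ[X] : Set
ℤ[X] = List ℤ

coeff : ℤ[X] → ℕ → ℤ
coeff []      _       = 0ℤ
coeff (a ∷ _) zero    = a
coeff (_ ∷ f) (suc i) = coeff f i

infix 4 _≈ₚ_
_≈ₚ_ : ℤ[X] → ℤ[X] → Set
f ≈ₚ g = ∀ i → coeff f i ≡ coeff g i

infixl 6 _+ₚ_
_+ₚ_ : ℤ[X] → ℤ[X] → ℤ[X]
[]      +ₚ g       = g
(a ∷ f) +ₚ []      = a ∷ f
(a ∷ f) +ₚ (b ∷ g) = a + b ∷ f +ₚ g

infixl 7 _·ₚ_
_·ₚ_ : ℤ → ℤ[X] → ℤ[X]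
c ·ₚ f = map (c *_) f

infixl 7 _*ₚ_
_*ₚ_ : ℤ[X] → ℤ[X] → ℤ[X]
[]      *ₚ g = []
(a ∷ f) *ₚ g = a ·ₚ g +ₚ (0ℤ ∷ f *ₚ g)

1ₚ : ℤ[X]
1ₚ = 1ℤ ∷ []

∏ₚ : List ℤ[X] → ℤ[X]
∏ₚ = foldr _*ₚ_ 1ₚ

X^_ : ℕ → ℤ[X]
X^ n = replicate n 0ℤ ++ 1ₚ

X^n-1 : ℕ → ℤ[X]
X^n-1 n = X^ n +ₚ (-1ℤ ∷ [])

-- The degree of the zero polynomial is set to 0.
deg : ℤ[X] → ℕ
deg []      = 0
deg (_ ∷ f) = if does (all? (_≟ᶻ 0ℤ) f) then 0 else suc (deg f)

-- (quotient , remainder) of f by a monic g, coefficient by coefficient: if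
-- f = q g + r with deg r < deg g, and t is the coefficient of X^(deg g) in
-- a + X r, then a + X f = (t + X q) g + (a + X r - t g).
divModₚ : ℤ[X] → ℤ[X] → ℤ[X] × ℤ[X]
divModₚ []      g = [] , []
divModₚ (a ∷ f) g =
  let (q , r) = divModₚ f g
      t       = coeff (a ∷ r) (deg g)
  in (t ∷ q) , (a ∷ r) +ₚ (- t) ·ₚ g

infixl 7 _divₚ_ _modₚ_
_divₚ_ _modₚ_ : ℤ[X] → ℤ[X] → ℤ[X]
f divₚ g = proj₁ (divModₚ f g)
f modₚ g = proj₂ (divModₚ f g)

coeff-+ₚ : ∀ f g i → coeff (f +ₚ g) i ≡ coeff f i + coeff g i
coeff-+ₚ []      g       i       = lemma (coeff g i)
  where lemma : ∀ x → x ≡ 0ℤ + x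
        lemma = solve-∀
coeff-+ₚ (a ∷ f) []      i       = lemma (coeff (a ∷ f) i)
  where lemma : ∀ x → x ≡ x + 0ℤ
        lemma = solve-∀
coeff-+ₚ (a ∷ f) (b ∷ g) zero    = refl
coeff-+ₚ (a ∷ f) (b ∷ g) (suc i) = coeff-+ₚ f g i

coeff-·ₚ : ∀ c f i → coeff (c ·ₚ f) i ≡ c * coeff f i
coeff-·ₚ c []      i       rewrite *-zeroʳ c = refl
coeff-·ₚ c (a ∷ f) zero    = refl
coeff-·ₚ c (a ∷ f) (suc i) = coeff-·ₚ c f i

divModₚ-identity : ∀ f g → f ≈ₚ f divₚ g *ₚ g +ₚ f modₚ g
divModₚ-identity []      g i = refl
divModₚ-identity (a ∷ f) g i = begin
  coeff (a ∷ f) i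
    ≡⟨ step i ⟩
  coeff (0ℤ ∷ q *ₚ g) i + coeff (a ∷ r) i
    ≡⟨ lemma t (coeff g i) _ _ ⟩
  (t * coeff g i + coeff (0ℤ ∷ q *ₚ g) i) + (coeff (a ∷ r) i + (- t) * coeff g i)
    ≡⟨ unfold ⟨
  coeff ((t ∷ q) *ₚ g +ₚ ((a ∷ r) +ₚ (- t) ·ₚ g)) i
    ∎
  where
  open ≡-Reasoning
  q = f divₚ g
  r = f modₚ g
  t = coeff (a ∷ r) (deg g)

  lemma : ∀ t x u v → u + v ≡ (t * x + u) + (v + (- t) * x)
  lemma = solve-∀

  step : ∀ i → coeff (a ∷ f) i ≡ coeff (0ℤ ∷ q *ₚ g) i + coeff (a ∷ r) i
  step zero    = zero-lemma a
    where zero-lemma : ∀ x → x ≡ 0ℤ + x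
          zero-lemma = solve-∀
  step (suc i) rewrite divModₚ-identity f g i = coeff-+ₚ (q *ₚ g) r i

  unfold : coeff ((t ∷ q) *ₚ g +ₚ ((a ∷ r) +ₚ (- t) ·ₚ g)) i
         ≡ (t * coeff g i + coeff (0ℤ ∷ q *ₚ g) i) + (coeff (a ∷ r) i + (- t) * coeff g i)
  unfold rewrite coeff-+ₚ ((t ∷ q) *ₚ g) ((a ∷ r) +ₚ (- t) ·ₚ g) i
               | coeff-+ₚ (t ·ₚ g) (0ℤ ∷ q *ₚ g) i
               | coeff-+ₚ (a ∷ r) ((- t) ·ₚ g) i
               | coeff-·ₚ t g i
               | coeff-·ₚ (- t) g i = refl

φ : ℕ → ℕ
φ n = length (filter (coprime? n) (applyUpTo suc n))

divisors : ℕ → List ℕ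
divisors n = filter (_∣? n) (applyUpTo suc n)

properDivisors : ℕ → List ℕ
properDivisors n = filter (_∣? n) (applyUpTo suc (n ∸ 1))

-- Cyclotomic polynomials, determined by X^n - 1 = ∏_{d ∣ n} Φ_d.  The first
-- argument of Φ-fuel bounds the recursion depth; `Φ-recursion` shows that the
-- bound n is enough.

Φ-fuel : ℕ → ℕ → ℤ[X]
Φ-fuel zero    n = 1ₚ
Φ-fuel (suc b) n = X^n-1 n divₚ ∏ₚ (map (Φ-fuel b) (properDivisors n))

Φ : ℕ → ℤ[X]
Φ n = Φ-fuel n n

properDivisors-bounds : ∀ n → All (λ d → 1 ≤ d × d ≤ n ∸ 1) (properDivisors n)
properDivisors-bounds n =
  filter⁺ (_∣? n) (applyUpTo⁺₁ suc (n ∸ 1) (λ i<m → s≤s z≤n , i<m))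

Φ-fuel-irrelevant : ∀ b c n → 1 ≤ n → n ≤ b → n ≤ c → Φ-fuel b n ≡ Φ-fuel c n
Φ-fuel-irrelevant (suc b) (suc c) n@(suc m) _ (s≤s m≤b) (s≤s m≤c) =
  cong (λ fs → X^n-1 n divₚ ∏ₚ fs)
    (map-cong-local (All.map
      (λ { {d} (1≤d , d≤m) → Φ-fuel-irrelevant b c d 1≤d (≤-trans d≤m m≤b) (≤-trans d≤m m≤c) })
      (properDivisors-bounds n)))

Φ-recursion : ∀ n → 1 ≤ n → Φ n ≡ X^n-1 n divₚ ∏ₚ (map Φ (properDivisors n))
Φ-recursion n@(suc m) _ =
  cong (λ fs → X^n-1 n divₚ ∏ₚ fs)
    (map-cong-local (All.map
      (λ { {d} (1≤d , d≤m) → Φ-fuel-irrelevant m d d 1≤d d≤m ≤-refl })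
      (properDivisors-bounds n)))

Matrix : ℕ → ℕ → Set
Matrix m n = Fin m → Fin n → ℤ

infix 4 _≈ₘ_
_≈ₘ_ : ∀ {m n} → Matrix m n → Matrix m n → Set
A ≈ₘ B = ∀ i j → A i j ≡ B i j

infixl 7 _*ₘ_
_*ₘ_ : ∀ {l m n} → Matrix l m → Matrix m n → Matrix l n
(A *ₘ B) i j = sum +-*-semiring (λ k → A i k * B k j)

1ₘ : ∀ {n} → Matrix n n
1ₘ i j = if does (i ≟ᶠ j) then 1ℤ else 0ℤ

Invertible : ∀ {n} → Matrix n n → Set
Invertible U = ∃[ W ] U *ₘ W ≈ₘ 1ₘ × W *ₘ U ≈ₘ 1ₘ

diagonal : ∀ {m n} → Matrix m n → List ℤ
diagonal {zero}  {_}     A = []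
diagonal {suc _} {zero}  A = []
diagonal {suc _} {suc _} A = A zero zero ∷ diagonal (λ i j → A (suc i) (suc j))

IsDiagonal : ∀ {m n} → Matrix m n → Set
IsDiagonal A = ∀ i j → toℕ i ≢ toℕ j → A i j ≡ 0ℤ

record IsSmithNormalForm {m n} (A S : Matrix m n) : Set where
  field
    U            : Matrix m m
    V            : Matrix n n
    U-invertible : Invertible U
    V-invertible : Invertible V
    equivalent   : U *ₘ A *ₘ V ≈ₘ S
    isDiagonal   : IsDiagonal S
    nonNegative  : All (0ℤ ≤ᶻ_) (diagonal S)
    divisibility : Linked _∣ᶻ_ (diagonal S)

infixl 7 _⊗_
_⊗_ : ∀ {k l m n} → Matrix k l → Matrix m n → Matrix (k ℕ.* m) (l ℕ.* n)
_⊗_ {m = m} {n} A B i j =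
  let (i₁ , i₂) = remQuot m i
      (j₁ , j₂) = remQuot n j
  in A i₁ j₁ * B i₂ j₂

∏ : ∀ {r} → Vector ℕ r → ℕ
∏ = foldrᵛ ℕ._*_ 1

⨂ : ∀ {r} {m n : Vector ℕ r} → (∀ j → Matrix (m j) (n j)) → Matrix (∏ m) (∏ n)
⨂ {zero}  M = λ _ _ → 1ℤ
⨂ {suc r} M = M zero ⊗ ⨂ (λ j → M (suc j))

-- Component at d of the natural map from ℤ[X]/(X^k - 1) to the direct sum of
-- the ℤ[X]/(Φ_d), d ∣ k.  The class of f modulo the monic Φ_d is represented
-- by its remainder, whose coefficients are its coordinates in the basis
-- 1, X, …, X^(φ(d) - 1).
Ψ : ℤ[X] → ℕ → ℤ[X]
Ψ f d = f modₚ Φ d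

-- The ordered basis of the codomain: (d , e) is X^e in the summand at d.
codomainBasis : ℕ → List (ℕ × ℕ)
codomainBasis k = concatMap (λ d → map (d ,_) (upTo (φ d))) (divisors k)

-- The matrix of Ψ_k: column j holds the coordinates of the image of X^j.  It
-- has Σ_{d ∣ k} φ(d) rows, which equals k, though not definitionally.
A : (k : ℕ) → Matrix (length (codomainBasis k)) k
A k i j = let (d , e) = lookup (codomainBasis k) i in coeff (Ψ (X^ toℕ j) d) e

-- Note that no e is the exponent of a prime in 0.
IsExponentOf : ℕ → ℤ → ℕ → Set
IsExponentOf p x e = + (p ^ e) ∣ᶻ x × ¬ (+ (p ^ suc e) ∣ᶻ x)

IsDecreasingRearrangement : List ℕ → List ℕ → Set
IsDecreasingRearrangement xs ys = xs ↭ ys × Linked _≥_ ys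

-- The values α - i, each φ(p^i) n / p^α times, for i = 0, …, α in this order.
exponents : (n p α : ℕ) → .{{NonZero p}} → List ℕ
exponents n p α =
  concatMap (λ i → replicate (φ (p ^ i) ℕ.* (n / p ^ α)) (α ∸ i)) (upTo (suc α))
  where instance _ = m^n≢0 p α

{-# OPTIONS --safe #-}
-- For a matrix diagonalised by unimodular matrices, the number of diagonal
-- entries divisible by p^e is the 𝔽_p-dimension of the reductions modulo p of
-- the integral vectors F with A F ≡ 0 mod p^e.  For A = A (p^α) this space can
-- be computed: A F ≡ 0 mod p^e says that each reduction of F modulo
-- X^(p^i) - 1 is p^(i-1)-periodic modulo p^e, which forces F to be
-- p^(α-e)-periodic modulo p (and to vanish modulo p if e > α), while every
-- p^(α-e)-periodic F does satisfy A F ≡ 0 mod p^e.  So p^(α-e) invariant factors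
-- of A (p^α) are divisible by p^e.  The same argument modulo a prime q ≠ p shows
-- that no invariant factor is divisible by q, hence in the Kronecker product the
-- exponents of p_j come from the j-th factor alone.
module Submission where

open import Defs
open import Data.Fin.Base as Fin using (Fin; _↑ʳ_; _↑ˡ_; combine; finToFun; fromℕ<; funToFin; inject≤; suc; toℕ; zero)
open import Data.Fin.Properties as Fin using (finToFun-funToFin; fromℕ<-cong; fromℕ<-toℕ; funToFin-finToFin; injective⇒≤; remQuot-combine; toℕ-fromℕ<; toℕ-injective; toℕ-inject≤; toℕ<n)
open import Data.Integer.Base as ℤ using (+_; -1ℤ; 0ℤ; 1ℤ; ℤ; ∣_∣)
open import Data.Integer.DivMod using (a≡a%ℕn+[a/ℕn]*n; n%ℕd<d)
open import Data.Integer.Divisibility using (_∣_)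
open import Data.Integer.Divisibility.Signed as ℤ∣ using (∣ᵤ⇒∣; ∣⇒∣ᵤ) renaming (_∣_ to _∣ₛ_)
open import Data.Integer.Properties as ℤ using ()
open import Data.Integer.Tactic.RingSolver using (solve-∀)
open import Data.List.Base using (List; []; _++_; _∷_; _∷ʳ_; allFin; applyUpTo; concat; concatMap; filter; length; lookup; map; replicate; tabulate; upTo)
open import Data.List.Membership.Propositional using (_∈_; _∉_; find; lose)
open import Data.List.Membership.Propositional.Properties using (∈-allFin; ∈-applyUpTo⁺; ∈-applyUpTo⁻; ∈-concatMap⁺; ∈-concatMap⁻; ∈-filter⁺; ∈-filter⁻; ∈-length; ∈-lookup; ∈-map⁺; ∈-map⁻; ∈-upTo⁺; ∈-upTo⁻; ∈-∃++)
open import Data.List.Properties using (++-identityʳ; applyUpTo-∷ʳ; concatMap-++; filter-++; filter-all; filter-none; filter-≐; length-++; length-applyUpTo; length-map; length-tabulate; length-upTo; map-++; map-id; map-replicate; map-tabulate; tabulate-cong)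
open import Data.List.Relation.Binary.Permutation.Propositional using (_↭_; prep; ↭-refl; ↭-sym; ↭-trans)
open import Data.List.Relation.Binary.Permutation.Propositional.Properties using (filter-↭; ↭-length) renaming (shift to ↭-shift)
open import Data.List.Relation.Binary.Pointwise as Pointwise using (Pointwise; []; _∷_)
open import Data.List.Relation.Unary.All as All using (All; []; _∷_; all?)
import Data.List.Relation.Unary.All.Properties as All
open import Data.List.Relation.Unary.AllPairs using (AllPairs; []; _∷_)
import Data.List.Relation.Unary.AllPairs.Properties as AllPairs
open import Data.List.Relation.Unary.Any using (Any; here; index; there)
open import Data.List.Relation.Unary.Any.Properties using (lookup-index)
open import Data.List.Relation.Unary.Linked using (Linked)
open import Data.List.Relation.Unary.Linked.Properties using (AllPairs⇒Linked)
open import Data.List.Relation.Unary.Unique.Propositional using (Unique)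
import Data.List.Relation.Unary.Unique.Propositional.Properties as Unique
open import Data.Nat.Base using (2+; >-nonZero⁻¹; NonZero; _*_; _+_; _<_; _^_; _∸_; _≤_; _≥_; _⊓_; nonTrivial⇒n>1; suc; s≤s; s≤s⁻¹; zero; z≤n; ℕ)
open import Data.Nat.Coprimality using (Coprime; coprime-divisor; coprime?)
open import Data.Nat.DivMod using (%-distribˡ-+; %-pred-≡0; %-remove-+ˡ; _%_; _/_; m%n%n≡m%n; m%n<n; m*n%n≡0; m/n*n≡m; m<n*o⇒m/o<n; m<n⇒m%n≡m; m∣n⇒o%n%m≡o%m; m≡m%n+[m/n]*n; n%1≡0; n%n≡0)
open import Data.Nat.Divisibility renaming (_∣_ to _∣ℕ_)
open import Data.Nat.Primality using (Prime; euclidsLemma; prime⇒irreducible; prime⇒nonTrivial; prime⇒nonZero; ¬prime[1])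
open import Data.Nat.Properties
import Data.Nat.Tactic.RingSolver as ℕ-Solver
open import Data.Product.Base using (_,_; _×_; proj₁; proj₂; ∃-syntax)
open import Data.Sum.Base using ([_,_]′; _⊎_; inj₁; inj₂)
open import Data.Vec.Functional using (Vector)
open import Function.Base using (_∘_; id)
open import Function.Bundles using (_⇔_; mk⇔)
open import Function.Definitions using (Injective)
open import Relation.Binary.Definitions using (tri<; tri>; tri≈)
open import Relation.Binary.PropositionalEquality
open import Relation.Nullary using (Dec; contradiction; no; yes; ¬_)
open import Relation.Nullary.Decidable using (dec-false; dec-true; ¬?)
open import Relation.Unary using (Decidable)

import Algebra.Properties.Semiring.Sum ℤ.+-*-semiring as Sum
open import Data.List.Membership.DecPropositional _≟_ using (_∈?_)
open ≡-Reasoning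

-- Division by X^m - 1 and by 1 + X^m + … + X^((p-1)m)

-- Write G_i for `F` folded to the residues modulo p^i. A row of Φ_(p^(i+1)) compares a block of
-- length p^i of G_(i+1) with its last block, whence the periodicity. Folding p congruent blocks
-- multiplies by p, so G_i agrees with p^(α-i) F below p^i. Periodicity of G_(i+1) then says that
-- p^(α-i-1) (F c' - F t) vanishes modulo p^e, where c' and t are the residues of one c modulo
-- p^(i+1) and p^i. Cancelling the power of p leaves a factor p exactly while α-i-1 < e, so the
-- descent stops at the period p^(α-e). With a prime q in place of p^e every power of p cancels;
-- hence the kernel lemmas take an arbitrary modulus `M` and a cancellation hypothesis. The
-- dimension is never built as a number: it is bounded on both sides by additive maps that are
-- injective modulo p, and these are compared by counting residue vectors. All of this needs
-- explicit remainders of X^c, because `Φ` is given only as the output of a recursive division.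

δ : ℕ → ℕ → ℤ
δ zero    zero    = 1ℤ
δ zero    (suc _) = 0ℤ
δ (suc _) zero    = 0ℤ
δ (suc a) (suc b) = δ a b

δ-refl : ∀ a → δ a a ≡ 1ℤ
δ-refl zero    = refl
δ-refl (suc a) = δ-refl a

δ-≢ : ∀ a b → a ≢ b → δ a b ≡ 0ℤ
δ-≢ zero    zero    a≢b = contradiction refl a≢b
δ-≢ zero    (suc b) a≢b = refl
δ-≢ (suc a) zero    a≢b = refl
δ-≢ (suc a) (suc b) a≢b = δ-≢ a b (a≢b ∘ cong suc)

suc-% : ∀ c k .{{_ : NonZero k}} → suc c % k ≡ suc (c % k) % k
suc-% c k = trans (%-distribˡ-+ 1 c k)
  (trans (cong (λ x → (1 % k + x) % k) (sym (m%n%n≡m%n c k))) (sym (%-distribˡ-+ 1 (c % k) k)))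

suc-%-< : ∀ c k .{{_ : NonZero k}} → suc (c % k) < k → suc c % k ≡ suc (c % k)
suc-%-< c k lt = trans (suc-% c k) (m<n⇒m%n≡m lt)

suc-%-≡ : ∀ c k .{{_ : NonZero k}} → suc (c % k) ≡ k → suc c % k ≡ 0
suc-%-≡ c k eq = trans (suc-% c k) (trans (cong (_% k) eq) (n%n≡0 k))

-- With `δ-%-zero`: multiplication by X rotates the residues modulo `k`. If `c % k` is the last
-- residue, `suc c % k` wraps to 0, and both sides vanish because `suc x < k`.
δ-%-suc : ∀ c k x .{{_ : NonZero k}} → suc x < k → δ (suc c % k) (suc x) ≡ δ (c % k) x
δ-%-suc c k x x<k with suc (c % k) <? k
... | yes lt rewrite suc-%-< c k lt = refl
... | no ≮k with eq ← ≤-antisym (m%n<n c k) (≮⇒≥ ≮k) rewrite suc-%-≡ c k eq =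
  sym (δ-≢ (c % k) x (λ c%k≡x → <-irrefl (trans (cong suc (sym c%k≡x)) eq) x<k))

δ-%-zero : ∀ c k → δ (suc c % suc k) 0 ≡ δ (c % suc k) k
δ-%-zero c k with suc (c % suc k) <? suc k
... | yes lt rewrite suc-%-< c (suc k) lt =
  sym (δ-≢ (c % suc k) k (λ c%k≡k → <-irrefl (cong suc c%k≡k) lt))
... | no ≮k with eq ← ≤-antisym (m%n<n c (suc k)) (≮⇒≥ ≮k)
  rewrite suc-%-≡ c (suc k) eq | suc-injective eq = sym (δ-refl k)

coeff-X^ : ∀ n i → coeff (X^ n) i ≡ δ n i
coeff-X^ zero    zero    = refl
coeff-X^ zero    (suc i) = refl
coeff-X^ (suc n) zero    = refl
coeff-X^ (suc n) (suc i) = coeff-X^ n i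

coeff-X^n-1 : ∀ n i → coeff (X^n-1 n) i ≡ δ n i ℤ.- δ 0 i
coeff-X^n-1 n i = trans (coeff-+ₚ (X^ n) (-1ℤ ∷ []) i) (cong₂ ℤ._+_ (coeff-X^ n i) (-1-coeff i))
  where
  -1-coeff : ∀ i → coeff (-1ℤ ∷ []) i ≡ ℤ.- δ 0 i
  -1-coeff zero    = refl
  -1-coeff (suc i) = refl

+ₚ-identityʳ : ∀ f → f +ₚ [] ≡ f
+ₚ-identityʳ []      = refl
+ₚ-identityʳ (_ ∷ _) = refl

coeff-zero⇒All : ∀ f → (∀ i → coeff f i ≡ 0ℤ) → All (_≡ 0ℤ) f
coeff-zero⇒All []      _ = []
coeff-zero⇒All (a ∷ f) h = h 0 ∷ coeff-zero⇒All f (h ∘ suc)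

All⇒coeff-zero : ∀ {f} → All (_≡ 0ℤ) f → ∀ i → coeff f i ≡ 0ℤ
All⇒coeff-zero []       _       = refl
All⇒coeff-zero (a ∷ f) zero    = a
All⇒coeff-zero (a ∷ f) (suc i) = All⇒coeff-zero f i

deg-unique : ∀ g d → coeff g d ≢ 0ℤ → (∀ j → d < j → coeff g j ≡ 0ℤ) → deg g ≡ d
deg-unique []      d       nz _ = contradiction refl nz
deg-unique (a ∷ f) zero    nz h
  rewrite dec-true (all? (ℤ._≟ 0ℤ) f) (coeff-zero⇒All f (λ i → h (suc i) (s≤s z≤n))) = refl
deg-unique (a ∷ f) (suc d) nz h
  rewrite dec-false (all? (ℤ._≟ 0ℤ) f) (λ all → nz (All⇒coeff-zero all d)) =
  cong suc (deg-unique f d nz (λ j d<j → h (suc j) (s≤s d<j)))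

-- As `X^ (suc c)` is `0ℤ ∷ X^ c`, this is the recursion by which the remainders of monomials are
-- computed below.
coeff-mod-∷ : ∀ a f g i → coeff ((a ∷ f) modₚ g) i ≡
              coeff (a ∷ f modₚ g) i ℤ.- coeff (a ∷ f modₚ g) (deg g) ℤ.* coeff g i
coeff-mod-∷ a f g i = begin
  coeff (h +ₚ (ℤ.- t) ·ₚ g) i             ≡⟨ coeff-+ₚ h ((ℤ.- t) ·ₚ g) i ⟩
  coeff h i ℤ.+ coeff ((ℤ.- t) ·ₚ g) i    ≡⟨ cong (λ x → coeff h i ℤ.+ x) (coeff-·ₚ (ℤ.- t) g i) ⟩
  coeff h i ℤ.+ (ℤ.- t) ℤ.* coeff g i     ≡⟨ cong (λ x → coeff h i ℤ.+ x) (ℤ.neg-distribˡ-* t (coeff g i)) ⟨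
  coeff h i ℤ.- t ℤ.* coeff g i           ∎
  where
  h = a ∷ f modₚ g
  t = coeff h (deg g)

-- The divisor is fixed only up to `≈ₚ`: it will be a product of cyclotomic polynomials, and a
-- quotient from `divModₚ` is as long as its dividend, hence padded with zeros. So the degree must
-- be read off the coefficients.
module _ (m′ : ℕ) (g : ℤ[X]) (g≈ : g ≈ₚ X^n-1 (suc m′)) where

  private
    m : ℕ
    m = suc m′

    coeff-g : ∀ i → coeff g i ≡ δ m i ℤ.- δ 0 i
    coeff-g i = trans (g≈ i) (coeff-X^n-1 m i)

    deg-g : deg g ≡ m
    deg-g = deg-unique g m
      (λ eq → contradiction (trans (sym eq) (trans (coeff-g m) (cong (ℤ._- 0ℤ) (δ-refl m)))) λ ())
      (λ { (suc j) m<j → trans (coeff-g (suc j)) (cong (ℤ._- 0ℤ) (δ-≢ m (suc j) (<⇒≢ m<j))) })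

  -- Multiplying the previous remainder by X reaches degree `m` only if `c % m` is `m′`; subtracting
  -- `g` once then moves that coefficient to position 0.
  coeff-X^-mod-X^n-1 : ∀ c i → coeff (X^ c modₚ g) i ≡ δ (c % m) i
  coeff-X^-mod-X^n-1 zero i rewrite coeff-mod-∷ 1ℤ [] g i | deg-g | ℤ.*-zeroˡ (coeff g i) =
    trans (ℤ.+-identityʳ _) (coeff-X^ 0 i)
  coeff-X^-mod-X^n-1 (suc c) i
    rewrite coeff-mod-∷ 0ℤ (X^ c) g i | deg-g | coeff-g i | coeff-X^-mod-X^n-1 c m′ = go i
    where
    go : ∀ i → coeff (0ℤ ∷ X^ c modₚ g) i ℤ.- δ (c % m) m′ ℤ.* (δ m i ℤ.- δ 0 i) ≡ δ (suc c % m) i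
    go zero    = trans (ring (δ (c % m) m′)) (sym (δ-%-zero c m′))
      where ring : ∀ x → 0ℤ ℤ.- x ℤ.* (0ℤ ℤ.- 1ℤ) ≡ x
            ring = solve-∀
    go (suc i) rewrite coeff-X^-mod-X^n-1 c i with <-cmp i m′
    ... | tri< i<m _ _ rewrite δ-≢ m′ i (≢-sym (<⇒≢ i<m)) =
      trans (ring (δ (c % m) i) (δ (c % m) m′)) (sym (δ-%-suc c m i (s≤s i<m)))
      where ring : ∀ x y → x ℤ.- y ℤ.* (0ℤ ℤ.- 0ℤ) ≡ x
            ring = solve-∀
    ... | tri≈ _ refl _ rewrite δ-refl i | δ-≢ (suc c % m) m (<⇒≢ (m%n<n (suc c) m)) = ring (δ (c % m) i)
      where ring : ∀ x → x ℤ.- x ℤ.* (1ℤ ℤ.- 0ℤ) ≡ 0ℤ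
            ring = solve-∀
    ... | tri> _ _ m<i
      rewrite δ-≢ m′ i (<⇒≢ m<i)
            | δ-≢ (c % m) i (<⇒≢ (<-≤-trans (m%n<n c m) m<i))
            | δ-≢ (suc c % m) (suc i) (<⇒≢ (<-trans (m%n<n (suc c) m) (s≤s m<i))) = ring (δ (c % m) m′)
      where ring : ∀ x → 0ℤ ℤ.- x ℤ.* (0ℤ ℤ.- 0ℤ) ≡ 0ℤ
            ring = solve-∀

  private
    -- Dropping `j` leading zeros leaves `0ℤ ∷ X^ l`, and the head of its quotient is the
    -- coefficient of degree `m` in X times the remainder of `X^ l`.
    coeff-X^-div : ∀ l j → coeff (X^ (j + suc l) divₚ g) j ≡ δ (l % m) m′
    coeff-X^-div l zero rewrite deg-g = coeff-X^-mod-X^n-1 l m′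
    coeff-X^-div l (suc j) = coeff-X^-div l j

    coeff-X^-div-≥ : ∀ c j → c ≤ j → coeff (X^ c divₚ g) j ≡ 0ℤ
    coeff-X^-div-≥ zero    zero    _ rewrite deg-g = refl
    coeff-X^-div-≥ zero    (suc j) _ = refl
    coeff-X^-div-≥ (suc c) (suc j) (s≤s c≤j) = coeff-X^-div-≥ c j c≤j

    m∣1+l⇒l%m≡m′ : ∀ l → m ∣ℕ suc l → l % m ≡ m′
    m∣1+l⇒l%m≡m′ l m∣ = %-pred-≡0 {l} {m} (n∣m⇒m%n≡0 (suc l) m m∣)

    l%m≡m′⇒m∣1+l : ∀ l → l % m ≡ m′ → m ∣ℕ suc l
    l%m≡m′⇒m∣1+l l eq = m%n≡0⇒n∣m (suc l) m (suc-%-≡ l m (cong suc eq))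

    -- Division yields the quotient indexed from the top, by `l`; since `j + suc l` is a multiple of
    -- `m`, `l` is -1 modulo `m` exactly when `j` is 0 modulo `m`.
    δ-divisible : ∀ l j → m ∣ℕ j + suc l → δ (l % m) m′ ≡ δ (j % m) 0
    δ-divisible l j m∣ with l % m ≟ m′
    ... | yes eq rewrite eq | n∣m⇒m%n≡0 j m (∣m+n∣m⇒∣n (subst (m ∣ℕ_) (+-comm j (suc l)) m∣) (l%m≡m′⇒m∣1+l l eq)) = δ-refl m′
    ... | no neq rewrite δ-≢ (l % m) m′ neq =
      sym (δ-≢ (j % m) 0 λ j≡0 → neq (m∣1+l⇒l%m≡m′ l (∣m+n∣m⇒∣n m∣ (m%n≡0⇒n∣m j m j≡0))))

  module _ (n′ : ℕ) (m∣n : m ∣ℕ suc n′) where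

    private
      n : ℕ
      n = suc n′

      -- The constant term -1 never reaches the quotient because `m` is positive, so the quotients
      -- of X^n - 1 and X^n agree.
      coeff-div′ : ∀ l j → j + suc l ≡ n → coeff (X^n-1 n divₚ g) j ≡ δ (l % m) m′
      coeff-div′ l zero    refl rewrite +ₚ-identityʳ (X^ n′) | deg-g = coeff-X^-mod-X^n-1 l m′
      coeff-div′ l (suc j) refl rewrite +ₚ-identityʳ (X^ n′) = coeff-X^-div l j

    -- These are the coefficients of the geometric sum 1 + X^m + ... + X^(n-m).
    coeff-X^n-1-div : ∀ j → j < n → coeff (X^n-1 n divₚ g) j ≡ δ (j % m) 0
    coeff-X^n-1-div j j<n with m≤n⇒∃[o]m+o≡n j<n
    ... | l , eq = trans (coeff-div′ l j eq′) (δ-divisible l j (subst (m ∣ℕ_) (sym eq′) m∣n))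
      where eq′ = trans (+-suc j l) eq

    coeff-X^n-1-div-≥ : ∀ j → n ≤ j → coeff (X^n-1 n divₚ g) j ≡ 0ℤ
    coeff-X^n-1-div-≥ (suc j) (s≤s n≤j) rewrite +ₚ-identityʳ (X^ n′) = coeff-X^-div-≥ n′ j n≤j

    coeff-X^n-1-mod : ∀ i → coeff (X^n-1 n modₚ g) i ≡ 0ℤ
    coeff-X^n-1-mod i
      rewrite +ₚ-identityʳ (X^ n′) | coeff-mod-∷ -1ℤ (X^ n′) g i | deg-g | coeff-g i
            | coeff-X^-mod-X^n-1 n′ m′ | m∣1+l⇒l%m≡m′ n′ m∣n | δ-refl m′ = go i
      where
      go : ∀ i → coeff (-1ℤ ∷ X^ n′ modₚ g) i ℤ.- 1ℤ ℤ.* (δ m i ℤ.- δ 0 i) ≡ 0ℤ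
      go zero    = refl
      go (suc i) rewrite coeff-X^-mod-X^n-1 n′ i | m∣1+l⇒l%m≡m′ n′ m∣n = ring (δ m′ i)
        where ring : ∀ x → x ℤ.- 1ℤ ℤ.* (x ℤ.- 0ℤ) ≡ 0ℤ
              ring = solve-∀

-- g = 1 + X^m + … + X^(p′ m), so that X^(p m) ≡ 1 mod g, where p = 1 + p′.
module _ (m′ p″ : ℕ) (g : ℤ[X]) where

  private
    -- `D` is the degree of `g`; `K′` and `D′` are K - 1 and D - 1, written so that their successors
    -- compute to `K` and `D`.
    m p′ p K D K′ D′ : ℕ
    m  = suc m′
    p′ = suc p″
    p  = suc p′
    D  = p′ * m
    K  = p * m
    K′ = m′ + D
    D′ = m′ + p″ * m

  module _ (coeff-g : ∀ j → j < K → coeff g j ≡ δ (j % m) 0)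
           (coeff-g-≥ : ∀ j → K ≤ j → coeff g j ≡ 0ℤ) where

    private
      D%m : D % m ≡ 0
      D%m = m*n%n≡0 p′ m

      D′%m : D′ % m ≡ m′
      D′%m = %-pred-≡0 {D′} {m} D%m

      D<K : D < K
      D<K = m<n+m D (s≤s z≤n)

      deg-g : deg g ≡ D
      deg-g = deg-unique g D
        (λ eq → contradiction (trans (sym eq) (trans (coeff-g D D<K) (cong (λ x → δ x 0) D%m))) λ ())
        above
        where
        above : ∀ j → D < j → coeff g j ≡ 0ℤ
        above j D<j with j <? K
        ... | no j≮K  = coeff-g-≥ j (≮⇒≥ j≮K)
        ... | yes j<K with m≤n⇒∃[o]m+o≡n D<j
        ... | l , refl = trans (coeff-g _ j<K) (cong (λ x → δ x 0) j%m)
          where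
          suc-l<m : suc l < m
          suc-l<m = +-cancelˡ-< D (suc l) m
            (subst₂ _<_ (sym (+-suc D l)) (+-comm m D) j<K)
          j%m : suc (D + l) % m ≡ suc l
          j%m = trans (cong (_% m) (sym (+-suc D l)))
            (trans (%-remove-+ˡ (suc l) {m} (n∣m*n p′)) (m<n⇒m%n≡m suc-l<m))

    -- Let w = `c % K`. If w < D, the remainder is X^w. Otherwise w = D + r with r < m, and reducing
    -- by `g` gives minus the sum of all X^i with i < D and i ≡ r modulo m; this is the second `δ`.
    coeff-X^-mod-Φ : ∀ c i → i < D → coeff (X^ c modₚ g) i ≡ δ (c % K) i ℤ.- δ (c % K) (D + i % m)
    coeff-X^-mod-Φ zero i i<D rewrite coeff-mod-∷ 1ℤ [] g i | deg-g | ℤ.*-zeroˡ (coeff g i) =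
      cong (ℤ._+ 0ℤ) (coeff-X^ 0 i)
    coeff-X^-mod-Φ (suc c) i i<D
      rewrite coeff-mod-∷ 0ℤ (X^ c) g i | deg-g | coeff-g i (<-trans i<D D<K)
            | coeff-X^-mod-Φ c D′ (n<1+n D′) | D′%m | +-comm D m′ = go i i<D
      where
      w = c % K
      w⁺ = suc c % K
      -- The multiple of `g` subtracted here is 1 if w = D - 1, where X^D appears; -1 if w = K - 1,
      -- where X^K wraps round to 1; and 0 otherwise.
      go : ∀ i → i < D → coeff (0ℤ ∷ X^ c modₚ g) i ℤ.- (δ w D′ ℤ.- δ w K′) ℤ.* δ (i % m) 0
                       ≡ δ w⁺ i ℤ.- δ w⁺ (D + i % m)
      go zero    _   rewrite +-identityʳ D′ | δ-%-suc c K D′ D<K | δ-%-zero c K′ = ring (δ w D′) (δ w K′)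
        where ring : ∀ x y → 0ℤ ℤ.- (x ℤ.- y) ℤ.* 1ℤ ≡ y ℤ.- x
              ring = solve-∀
      go (suc i) i<D
        rewrite coeff-X^-mod-Φ c i (<-trans (n<1+n i) i<D) | δ-%-suc c K i (<-trans i<D D<K)
        with suc (i % m) <? m
      ... | yes lt
        rewrite suc-%-< i m lt | +-suc D′ (i % m)
              | δ-%-suc c K (D + i % m) (subst₂ _<_ (+-suc D (i % m)) (+-comm D m) (+-monoʳ-< D lt)) =
        ring (δ w i) (δ w (D + i % m)) (δ w D′ ℤ.- δ w K′)
        where
        ring : ∀ x y z → (x ℤ.- y) ℤ.- z ℤ.* 0ℤ ≡ x ℤ.- y
        ring = solve-∀
      ... | no ≮m with eq ← ≤-antisym (m%n<n i m) (≮⇒≥ ≮m)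
        rewrite suc-%-≡ i m eq | suc-injective eq | +-identityʳ D′ | +-comm D m′ | δ-%-suc c K D′ D<K =
        ring (δ w i) (δ w D′) (δ w K′)
        where ring : ∀ x y z → (x ℤ.- z) ℤ.- (y ℤ.- z) ℤ.* 1ℤ ≡ x ℤ.- y
              ring = solve-∀

-- Commutation of polynomial products

shift : (ℕ → ℤ) → ℕ → ℤ
shift u zero    = 0ℤ
shift u (suc n) = u n

-- The coefficients of f *ₚ g, as the value of f at the shift operator applied
-- to the coefficients u of g: in this form products visibly commute.
act : ℤ[X] → (ℕ → ℤ) → ℕ → ℤ
act []      u n = 0ℤ
act (a ∷ f) u n = a ℤ.* u n ℤ.+ shift (act f u) n

shift-cong : ∀ {u v} → u ≗ v → shift u ≗ shift v
shift-cong u≗v zero    = refl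
shift-cong u≗v (suc n) = u≗v n

act-cong : ∀ f {u v} → u ≗ v → act f u ≗ act f v
act-cong []      u≗v n = refl
act-cong (a ∷ f) u≗v n = cong₂ ℤ._+_ (cong (a ℤ.*_) (u≗v n)) (shift-cong (act-cong f u≗v) n)

coeff-*ₚ : ∀ f g → coeff (f *ₚ g) ≗ act f (coeff g)
coeff-*ₚ []      g n = refl
coeff-*ₚ (a ∷ f) g n =
  trans (coeff-+ₚ (a ·ₚ g) (0ℤ ∷ f *ₚ g) n) (cong₂ ℤ._+_ (coeff-·ₚ a g n) (tail n))
  where
  tail : ∀ n → coeff (0ℤ ∷ f *ₚ g) n ≡ shift (act f (coeff g)) n
  tail zero    = refl
  tail (suc n) = coeff-*ₚ f g n

act-shift : ∀ f u → act f (shift u) ≗ shift (act f u)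
act-shift []      u zero    = refl
act-shift []      u (suc n) = refl
act-shift (a ∷ f) u zero    = cong (ℤ._+ 0ℤ) (ℤ.*-zeroʳ a)
act-shift (a ∷ f) u (suc n) = cong (λ x → a ℤ.* u n ℤ.+ x) (act-shift f u n)

act-linear : ∀ f b u v n → act f (λ i → b ℤ.* u i ℤ.+ v i) n ≡ b ℤ.* act f u n ℤ.+ act f v n
act-linear []      b u v n       = sym (trans (ℤ.+-identityʳ _) (ℤ.*-zeroʳ b))
act-linear (a ∷ f) b u v zero    = ring a b (u 0) (v 0)
  where ring : ∀ a b x y → a ℤ.* (b ℤ.* x ℤ.+ y) ℤ.+ 0ℤ ≡ b ℤ.* (a ℤ.* x ℤ.+ 0ℤ) ℤ.+ (a ℤ.* y ℤ.+ 0ℤ)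
        ring = solve-∀
act-linear (a ∷ f) b u v (suc n) rewrite act-linear f b u v n =
  ring a b (u (suc n)) (v (suc n)) (act f u n) (act f v n)
  where ring : ∀ a b x y z w → a ℤ.* (b ℤ.* x ℤ.+ y) ℤ.+ (b ℤ.* z ℤ.+ w)
                             ≡ b ℤ.* (a ℤ.* x ℤ.+ z) ℤ.+ (a ℤ.* y ℤ.+ w)
        ring = solve-∀

-- Induction on `f` alone suffices, because `act g` is linear and commutes with `shift`.
act-comm : ∀ f g u → act f (act g u) ≗ act g (act f u)
act-comm []      g u n = sym (act-zero g n)
  where
  act-zero : ∀ g n → act g (λ _ → 0ℤ) n ≡ 0ℤ
  act-zero []      n       = refl
  act-zero (b ∷ g) zero    = cong (ℤ._+ 0ℤ) (ℤ.*-zeroʳ b)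
  act-zero (b ∷ g) (suc n) = cong₂ ℤ._+_ (ℤ.*-zeroʳ b) (act-zero g n)
act-comm (a ∷ f) g u n = begin
  a ℤ.* act g u n ℤ.+ shift (act f (act g u)) n
    ≡⟨ cong (λ x → a ℤ.* act g u n ℤ.+ x) (shift-cong (act-comm f g u) n) ⟩
  a ℤ.* act g u n ℤ.+ shift (act g (act f u)) n
    ≡⟨ cong (λ x → a ℤ.* act g u n ℤ.+ x) (act-shift g (act f u) n) ⟨
  a ℤ.* act g u n ℤ.+ act g (shift (act f u)) n
    ≡⟨ act-linear g a u (shift (act f u)) n ⟨
  act g (act (a ∷ f) u) n
    ∎

-- Increasing divisor lists put the newest cyclotomic polynomial last, while the division identity
-- has it, as the quotient, on the left.
∏ₚ-∷ʳ : ∀ fs h → ∏ₚ (fs ∷ʳ h) ≈ₚ h *ₚ ∏ₚ fs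
∏ₚ-∷ʳ []       h n = refl
∏ₚ-∷ʳ (f ∷ fs) h n = begin
  coeff (f *ₚ ∏ₚ (fs ∷ʳ h)) n     ≡⟨ coeff-*ₚ f (∏ₚ (fs ∷ʳ h)) n ⟩
  act f (coeff (∏ₚ (fs ∷ʳ h))) n  ≡⟨ act-cong f (λ i → trans (∏ₚ-∷ʳ fs h i) (coeff-*ₚ h (∏ₚ fs) i)) n ⟩
  act f (act h (coeff (∏ₚ fs))) n ≡⟨ act-comm f h (coeff (∏ₚ fs)) n ⟩
  act h (act f (coeff (∏ₚ fs))) n ≡⟨ act-cong h (λ i → sym (coeff-*ₚ f (∏ₚ fs) i)) n ⟩
  act h (coeff (f *ₚ ∏ₚ fs)) n    ≡⟨ coeff-*ₚ h (f *ₚ ∏ₚ fs) n ⟨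
  coeff (h *ₚ (f *ₚ ∏ₚ fs)) n     ∎

X^n-1-mod-X^m-1 : ∀ m n .{{_ : NonZero m}} .{{_ : NonZero n}} → m ∣ℕ n →
                  ∀ g → g ≈ₚ X^n-1 m → ∀ i → coeff (X^n-1 n modₚ g) i ≡ 0ℤ
X^n-1-mod-X^m-1 (suc m′) (suc n′) m∣n g g≈ = coeff-X^n-1-mod m′ g g≈ n′ m∣n

X^-mod-quotient : ∀ m p″ .{{_ : NonZero m}} .{{_ : NonZero (suc (suc p″) * m)}} →
                  ∀ g → g ≈ₚ X^n-1 m → ∀ c i → i < suc p″ * m →
                  coeff (X^ c modₚ (X^n-1 (suc (suc p″) * m) divₚ g)) i ≡
                  δ (c % (suc (suc p″) * m)) i ℤ.- δ (c % (suc (suc p″) * m)) (suc p″ * m + i % m)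
X^-mod-quotient (suc m′) p″ g g≈ = coeff-X^-mod-Φ m′ p″ _
  (coeff-X^n-1-div m′ g g≈ _ (n∣m*n (suc (suc p″)))) (coeff-X^n-1-div-≥ m′ g g≈ _ (n∣m*n (suc (suc p″))))

-- Divisors, totients and cyclotomic polynomials of prime powers

-- Reduces the identification of a filtered range with an explicit list to two inclusions.
<-sorted-unique : ∀ {xs ys} → AllPairs _<_ xs → AllPairs _<_ ys →
                  (∀ {z} → z ∈ xs → z ∈ ys) → (∀ {z} → z ∈ ys → z ∈ xs) → xs ≡ ys
<-sorted-unique {[]}     {[]}     _ _ _ _ = refl
<-sorted-unique {[]}     {y ∷ ys} _ _ _ ⊇ with () ← ⊇ (here refl)
<-sorted-unique {x ∷ xs} {[]}     _ _ ⊆ _ with () ← ⊆ (here refl)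
<-sorted-unique {x ∷ xs} {y ∷ ys} (x< ∷ xs↗) (y< ∷ ys↗) ⊆ ⊇ =
  cong₂ _∷_ x≡y (<-sorted-unique xs↗ ys↗
    (λ z∈ → tail (λ z≡y → <⇒≢ (All.lookup x< z∈) (trans x≡y (sym z≡y))) (⊆ (there z∈)))
    (λ z∈ → tail (λ z≡x → <⇒≢ (All.lookup y< z∈) (trans (sym x≡y) (sym z≡x))) (⊇ (there z∈))))
  where
  tail : ∀ {z w ws} → z ≢ w → z ∈ w ∷ ws → z ∈ ws
  tail z≢w (here z≡w)  = contradiction z≡w z≢w
  tail z≢w (there z∈) = z∈
  x≡y : x ≡ y
  x≡y with ⊆ (here refl) | ⊇ (here refl)
  ... | here eq  | _        = eq
  ... | there _  | here eq  = sym eq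
  ... | there x∈ | there y∈ = contradiction (All.lookup x< y∈) (<-asym (All.lookup y< x∈))

length-filter-¬ : ∀ {A : Set} {P : A → Set} (P? : Decidable P) xs →
                  length (filter P? xs) + length (filter (¬? ∘ P?) xs) ≡ length xs
length-filter-¬ P? []       = refl
length-filter-¬ P? (x ∷ xs) with P? x
... | yes _ = cong suc (length-filter-¬ P? xs)
... | no  _ = trans (+-suc _ _) (cong suc (length-filter-¬ P? xs))

upTo-suc-↗ : ∀ n → AllPairs _<_ (applyUpTo suc n)
upTo-suc-↗ n = AllPairs.applyUpTo⁺₁ suc n (λ i<j _ → s≤s i<j)

^-monoʳ-∣ : ∀ q {i j} → i ≤ j → q ^ i ∣ℕ q ^ j
^-monoʳ-∣ q {i} i≤j with o , refl ← m≤n⇒∃[o]m+o≡n i≤j =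
  subst (q ^ i ∣ℕ_) (sym (^-distribˡ-+-* q i o)) (m∣m*n (q ^ o))

module PrimePower (p″ : ℕ) (p-prime : Prime (2+ p″)) where

  p p′ : ℕ
  p  = 2+ p″
  p′ = suc p″

  infixl 7 _%p^_
  _%p^_ : ℕ → ℕ → ℕ
  c %p^ i = _%_ c (p ^ i) {{m^n≢0 p i}}

  %p^-< : ∀ c i → c %p^ i < p ^ i
  %p^-< c i = m%n<n c (p ^ i) {{m^n≢0 p i}}

  p∤⇒coprime : ∀ {d} → ¬ p ∣ℕ d → Coprime d p
  p∤⇒coprime p∤d (c∣d , c∣p) = [ id , (λ { refl → contradiction c∣d p∤d }) ]′ (prime⇒irreducible p-prime c∣p)

  ∣p^⇒≡p^ : ∀ i {d} → d ∣ℕ p ^ i → ∃[ j ] j ≤ i × d ≡ p ^ j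
  ∣p^⇒≡p^ zero    d∣1 = 0 , z≤n , ∣1⇒≡1 d∣1
  ∣p^⇒≡p^ (suc i) {d} d∣ with p ∣? d
  ... | no p∤d with j , j≤i , eq ← ∣p^⇒≡p^ i (coprime-divisor (p∤⇒coprime p∤d) d∣) = j , m≤n⇒m≤1+n j≤i , eq
  ... | yes (divides-refl q)
    with j , j≤i , eq ← ∣p^⇒≡p^ i {q} (*-cancelˡ-∣ p (subst (_∣ℕ p * p ^ i) (*-comm q p) d∣)) =
    suc j , s≤s j≤i , trans (*-comm q p) (cong (p *_) eq)

  p^-mono-< : ∀ {i j} → i < j → p ^ i < p ^ j
  p^-mono-< = ^-monoʳ-< p (s≤s (s≤s z≤n))

  private
    p^-↗ : ∀ n → AllPairs _<_ (applyUpTo (p ^_) n)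
    p^-↗ n = AllPairs.applyUpTo⁺₁ (p ^_) n (λ i<j _ → p^-mono-< i<j)

    ∈-upTo-suc : ∀ {x n} → 0 < x → x ≤ n → x ∈ applyUpTo suc n
    ∈-upTo-suc {suc x} _ x<n = ∈-applyUpTo⁺ suc x<n

  divisors-p^ : ∀ i → divisors (p ^ i) ≡ applyUpTo (p ^_) (suc i)
  divisors-p^ i = <-sorted-unique (AllPairs.filter⁺ (_∣? p ^ i) (upTo-suc-↗ (p ^ i))) (p^-↗ (suc i)) to from
    where
    to : ∀ {z} → z ∈ divisors (p ^ i) → z ∈ applyUpTo (p ^_) (suc i)
    to z∈ with _ , z∣ ← ∈-filter⁻ (_∣? p ^ i) {xs = applyUpTo suc (p ^ i)} z∈
          with j , j≤i , refl ← ∣p^⇒≡p^ i z∣ = ∈-applyUpTo⁺ (p ^_) (s≤s j≤i)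
    from : ∀ {z} → z ∈ applyUpTo (p ^_) (suc i) → z ∈ divisors (p ^ i)
    from z∈ with j , s≤s j≤i , refl ← ∈-applyUpTo⁻ (p ^_) z∈ =
      ∈-filter⁺ (_∣? p ^ i) (∈-upTo-suc (m^n>0 p j) (^-monoʳ-≤ p j≤i)) (^-monoʳ-∣ p j≤i)

  properDivisors-p^ : ∀ i → properDivisors (p ^ suc i) ≡ applyUpTo (p ^_) (suc i)
  properDivisors-p^ i =
    <-sorted-unique (AllPairs.filter⁺ (_∣? p ^ suc i) (upTo-suc-↗ (p ^ suc i ∸ 1))) (p^-↗ (suc i)) to from
    where
    to : ∀ {z} → z ∈ properDivisors (p ^ suc i) → z ∈ applyUpTo (p ^_) (suc i)
    to z∈ with z∈′ , z∣ ← ∈-filter⁻ (_∣? p ^ suc i) {xs = applyUpTo suc (p ^ suc i ∸ 1)} z∈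
          with k , k< , eq ← ∈-applyUpTo⁻ suc z∈′
          with j , j≤i , refl ← ∣p^⇒≡p^ (suc i) z∣ with m≤n⇒m<n∨m≡n j≤i
    ... | inj₁ j<i  = ∈-applyUpTo⁺ (p ^_) j<i
    ... | inj₂ refl = contradiction (subst (_< p ^ suc i ∸ 1) (cong (_∸ 1) (sym eq)) k<) (<-irrefl refl)
    from : ∀ {z} → z ∈ applyUpTo (p ^_) (suc i) → z ∈ properDivisors (p ^ suc i)
    from z∈ with j , j<i , refl ← ∈-applyUpTo⁻ (p ^_) z∈ =
      ∈-filter⁺ (_∣? p ^ suc i)
        (∈-upTo-suc (m^n>0 p j) (∸-monoˡ-≤ 1 (p^-mono-< j<i)))
        (proj₂ (∈-filter⁻ (_∣? p ^ suc i) {xs = applyUpTo suc (p ^ suc i)}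
          (subst (p ^ j ∈_) (sym (divisors-p^ (suc i))) (∈-applyUpTo⁺ (p ^_) (m≤n⇒m≤1+n j<i)))))

  p^-coprime⇒∤ : ∀ i {x} → Coprime (p ^ suc i) x → ¬ p ∣ℕ x
  p^-coprime⇒∤ i cop p∣x with () ← cop (m∣m*n (p ^ i) , p∣x)

  ∤⇒p^-coprime : ∀ i {x} → ¬ p ∣ℕ x → Coprime (p ^ i) x
  ∤⇒p^-coprime i p∤x (c∣p^ , c∣x) with ∣p^⇒≡p^ i c∣p^
  ... | zero  , _ , eq   = eq
  ... | suc j , _ , refl = contradiction (∣-trans (m∣m*n (p ^ j)) c∣x) p∤x

  multiples : ∀ m → filter (p ∣?_) (applyUpTo suc (p * m)) ≡ applyUpTo (λ j → p * suc j) m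
  multiples m = <-sorted-unique (AllPairs.filter⁺ (p ∣?_) (upTo-suc-↗ (p * m)))
    (AllPairs.applyUpTo⁺₁ _ m (λ i<j _ → *-monoʳ-< p (s≤s i<j))) to from
    where
    to : ∀ {z} → z ∈ filter (p ∣?_) (applyUpTo suc (p * m)) → z ∈ applyUpTo (λ j → p * suc j) m
    to z∈ with z∈′ , divides q eq ← ∈-filter⁻ (p ∣?_) {xs = applyUpTo suc (p * m)} z∈
          with k , k< , refl ← ∈-applyUpTo⁻ suc z∈′ with q
    ... | zero  with () ← eq
    ... | suc q = subst (_∈ applyUpTo (λ j → p * suc j) m) (trans (*-comm p (suc q)) (sym eq))
      (∈-applyUpTo⁺ _ (*-cancelˡ-≤ p (subst (_≤ p * m) (trans eq (*-comm (suc q) p)) k<)))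
    from : ∀ {z} → z ∈ applyUpTo (λ j → p * suc j) m → z ∈ filter (p ∣?_) (applyUpTo suc (p * m))
    from z∈ with j , j<m , refl ← ∈-applyUpTo⁻ (λ j → p * suc j) z∈ =
      ∈-filter⁺ (p ∣?_) (∈-upTo-suc (s≤s z≤n) (*-monoʳ-≤ p j<m)) (m∣m*n (suc j))

  -- Among 1, ..., p^(i+1), the numbers not coprime to p^(i+1) are the p^i multiples of p.
  φ-p^ : ∀ i → φ (p ^ suc i) ≡ p′ * p ^ i
  φ-p^ i = +-cancelˡ-≡ (p ^ i) _ _ (begin
    p ^ i + φ (p ^ suc i)
      ≡⟨ cong₂ _+_
           (sym (trans (cong length (multiples (p ^ i))) (length-applyUpTo (λ j → p * suc j) (p ^ i))))
           (cong length (filter-≐ (coprime? (p ^ suc i)) (¬? ∘ (p ∣?_))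
                          (p^-coprime⇒∤ i , ∤⇒p^-coprime (suc i)) xs)) ⟩
    length (filter (p ∣?_) xs) + length (filter (¬? ∘ (p ∣?_)) xs)
      ≡⟨ length-filter-¬ (p ∣?_) xs ⟩
    length xs
      ≡⟨ length-applyUpTo suc (p ^ suc i) ⟩
    p ^ suc i
      ∎)
    where xs = applyUpTo suc (p ^ suc i)

  -- The totients telescope by `φ-p^`. Only through this equation is `A (p ^ α)` square.
  length-codomainBasis : ∀ α → length (codomainBasis (p ^ α)) ≡ p ^ α
  length-codomainBasis α = trans (cong (length ∘ concatMap block) (divisors-p^ α)) (go α)
    where
    block : ℕ → List (ℕ × ℕ)
    block d = map (d ,_) (upTo (φ d))

    length-block : ∀ d → length (block d) ≡ φ d
    length-block d = trans (length-map (d ,_) (upTo (φ d))) (length-upTo (φ d))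

    go : ∀ α → length (concatMap block (applyUpTo (p ^_) (suc α))) ≡ p ^ α
    go zero    = refl
    go (suc α) = begin
      length (concatMap block (applyUpTo (p ^_) (2+ α)))
        ≡⟨ cong (length ∘ concatMap block) (applyUpTo-∷ʳ (p ^_) (suc α)) ⟨
      length (concatMap block (applyUpTo (p ^_) (suc α) ∷ʳ p ^ suc α))
        ≡⟨ cong length (concatMap-++ block (applyUpTo (p ^_) (suc α)) _) ⟩
      length (concatMap block (applyUpTo (p ^_) (suc α)) ++ block (p ^ suc α) ++ [])
        ≡⟨ length-++ (concatMap block (applyUpTo (p ^_) (suc α))) ⟩
      length (concatMap block (applyUpTo (p ^_) (suc α))) + length (block (p ^ suc α) ++ [])
        ≡⟨ cong₂ _+_ (go α) (trans (cong length (++-identityʳ (block (p ^ suc α)))) (length-block (p ^ suc α))) ⟩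
      p ^ α + φ (p ^ suc α)
        ≡⟨ cong (_+_ (p ^ α)) (φ-p^ α) ⟩
      p ^ suc α
        ∎

  ∈-codomainBasis⁺ : ∀ {α i e} → i ≤ α → e < φ (p ^ i) → (p ^ i , e) ∈ codomainBasis (p ^ α)
  ∈-codomainBasis⁺ {α} {i} i≤α e<φ = ∈-concatMap⁺ _
    (lose (subst (p ^ i ∈_) (sym (divisors-p^ α)) (∈-applyUpTo⁺ (p ^_) (s≤s i≤α))) (∈-map⁺ _ (∈-upTo⁺ e<φ)))

  ∈-codomainBasis⁻ : ∀ {α d e} → (d , e) ∈ codomainBasis (p ^ α) →
                     ∃[ i ] i ≤ α × d ≡ p ^ i × e < φ (p ^ i)
  ∈-codomainBasis⁻ {α} de∈ with d′ , d′∈ , de∈′ ← find (∈-concatMap⁻ _ {xs = divisors (p ^ α)} de∈)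
    with e′ , e′∈ , refl ← ∈-map⁻ (d′ ,_) de∈′
    with i , s≤s i≤α , refl ← ∈-applyUpTo⁻ (p ^_) (subst (d′ ∈_) (divisors-p^ α) d′∈) =
    i , i≤α , refl , ∈-upTo⁻ e′∈

  private
    ∏Φ : ℕ → ℤ[X]
    ∏Φ i = ∏ₚ (map Φ (applyUpTo (p ^_) (suc i)))

    Φ-p^ : ∀ i → Φ (p ^ suc i) ≡ X^n-1 (p ^ suc i) divₚ ∏Φ i
    Φ-p^ i = trans (Φ-recursion (p ^ suc i) (m^n>0 p (suc i)))
      (cong (λ ds → X^n-1 (p ^ suc i) divₚ ∏ₚ (map Φ ds)) (properDivisors-p^ i))

    p^i∣p^1+i : ∀ i → p ^ i ∣ℕ p ^ suc i
    p^i∣p^1+i i = n∣m*n p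

  -- The division defining Φ (p^(i+1)) leaves no remainder, since its divisor is X^(p^i) - 1 by
  -- induction; so quotient times divisor gives back X^(p^(i+1)) - 1.
  ∏Φ≈X^n-1 : ∀ i → ∏Φ i ≈ₚ X^n-1 (p ^ i)
  ∏Φ≈X^n-1 zero    i = refl
  ∏Φ≈X^n-1 (suc i) j = begin
    coeff (∏Φ (suc i)) j
      ≡⟨ cong (λ ds → coeff (∏ₚ (map Φ ds)) j) (applyUpTo-∷ʳ (p ^_) (suc i)) ⟨
    coeff (∏ₚ (map Φ (applyUpTo (p ^_) (suc i) ∷ʳ p ^ suc i))) j
      ≡⟨ cong (λ fs → coeff (∏ₚ fs) j) (map-++ Φ (applyUpTo (p ^_) (suc i)) _) ⟩
    coeff (∏ₚ (map Φ (applyUpTo (p ^_) (suc i)) ∷ʳ Φ (p ^ suc i))) j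
      ≡⟨ ∏ₚ-∷ʳ (map Φ (applyUpTo (p ^_) (suc i))) (Φ (p ^ suc i)) j ⟩
    coeff (Φ (p ^ suc i) *ₚ ∏Φ i) j
      ≡⟨ cong (λ f → coeff (f *ₚ ∏Φ i) j) (Φ-p^ i) ⟩
    coeff (X^n-1 n divₚ ∏Φ i *ₚ ∏Φ i) j
      ≡⟨ ℤ.+-identityʳ _ ⟨
    coeff (X^n-1 n divₚ ∏Φ i *ₚ ∏Φ i) j ℤ.+ 0ℤ
      ≡⟨ cong (λ x → coeff (X^n-1 n divₚ ∏Φ i *ₚ ∏Φ i) j ℤ.+ x)
           (sym (X^n-1-mod-X^m-1 (p ^ i) n {{m^n≢0 p i}} {{m^n≢0 p (suc i)}} (p^i∣p^1+i i) (∏Φ i) (∏Φ≈X^n-1 i) j)) ⟩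
    coeff (X^n-1 n divₚ ∏Φ i *ₚ ∏Φ i) j ℤ.+ coeff (X^n-1 n modₚ ∏Φ i) j
      ≡⟨ coeff-+ₚ (X^n-1 n divₚ ∏Φ i *ₚ ∏Φ i) (X^n-1 n modₚ ∏Φ i) j ⟨
    coeff (X^n-1 n divₚ ∏Φ i *ₚ ∏Φ i +ₚ X^n-1 n modₚ ∏Φ i) j
      ≡⟨ divModₚ-identity (X^n-1 n) (∏Φ i) j ⟨
    coeff (X^n-1 n) j
      ∎
    where n = p ^ suc i

  coeff-X^-mod-Φ1 : ∀ c → coeff (X^ c modₚ Φ 1) 0 ≡ 1ℤ
  coeff-X^-mod-Φ1 c = trans (coeff-X^-mod-X^n-1 0 (Φ 1) (λ _ → refl) c 0) (cong (λ x → δ x 0) (n%1≡0 c))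

  coeff-X^-mod-Φp^ : ∀ i c e → e < p′ * p ^ i → coeff (X^ c modₚ Φ (p ^ suc i)) e ≡
                     δ (c %p^ suc i) e ℤ.- δ (c %p^ suc i) (p′ * p ^ i + e %p^ i)
  coeff-X^-mod-Φp^ i c e e<D = trans (cong (λ f → coeff (X^ c modₚ f) e) (Φ-p^ i))
    (X^-mod-quotient (p ^ i) p″ {{m^n≢0 p i}} {{m^n≢0 p (suc i)}} (∏Φ i) (∏Φ≈X^n-1 i) c e e<D)

-- The kernel of A (p ^ α) modulo prime powers

-- Indexing by natural numbers lets sums be split along u * b + v without casts between `Fin` types.
∑ : ℕ → (ℕ → ℤ) → ℤ
∑ n f = Sum.sum {n} (f ∘ toℕ)

∑-cong : ∀ n {f g : ℕ → ℤ} → (∀ i → i < n → f i ≡ g i) → ∑ n f ≡ ∑ n g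
∑-cong n f≗g = Sum.sum-cong-≗ (λ i → f≗g (toℕ i) (toℕ<n i))

∑-+ : ∀ a b f → ∑ (a + b) f ≡ ∑ a f ℤ.+ ∑ b (λ i → f (a + i))
∑-+ zero    b f = sym (ℤ.+-identityˡ _)
∑-+ (suc a) b f = trans (cong (λ x → f 0 ℤ.+ x) (∑-+ a b (f ∘ suc))) (sym (ℤ.+-assoc (f 0) _ _))

∑-* : ∀ a b f → ∑ (a * b) f ≡ ∑ a (λ u → ∑ b (λ v → f (u * b + v)))
∑-* zero    b f = refl
∑-* (suc a) b f = trans (∑-+ b (a * b) f) (cong (λ x → ∑ b f ℤ.+ x)
  (trans (∑-* a b (λ i → f (b + i)))
    (∑-cong a λ u _ → ∑-cong b λ v _ → cong f (sym (+-assoc b (u * b) v)))))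

∑-comm : ∀ a b (f : ℕ → ℕ → ℤ) → ∑ a (λ u → ∑ b (λ v → f u v)) ≡ ∑ b (λ v → ∑ a (λ u → f u v))
∑-comm a b f = Sum.∑-comm {a} {b} (λ i j → f (toℕ i) (toℕ j))

∑-distrib-- : ∀ n f g → ∑ n (λ i → f i ℤ.- g i) ≡ ∑ n f ℤ.- ∑ n g
∑-distrib-- zero    f g = refl
∑-distrib-- (suc n) f g rewrite ∑-distrib-- n (f ∘ suc) (g ∘ suc) =
  ring (f 0) (g 0) (∑ n (f ∘ suc)) (∑ n (g ∘ suc))
  where ring : ∀ a b c d → a ℤ.- b ℤ.+ (c ℤ.- d) ≡ a ℤ.+ c ℤ.- (b ℤ.+ d)
        ring = solve-∀

∑-const : ∀ n x → ∑ n (λ _ → x) ≡ ℤ.+ n ℤ.* x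
∑-const zero    x = refl
∑-const (suc n) x = trans (cong (λ y → x ℤ.+ y) (∑-const n x)) (sym (ℤ.suc-* (ℤ.+ n) x))

∑-∣ : ∀ n {m} f → (∀ i → i < n → m ∣ₛ f i) → m ∣ₛ ∑ n f
∑-∣ zero    f h = ℤ∣.divides 0ℤ refl
∑-∣ (suc n) f h = ℤ∣.∣m∣n⇒∣m+n (h 0 (s≤s z≤n)) (∑-∣ n (f ∘ suc) (λ i i<n → h (suc i) (s≤s i<n)))

∑-zero : ∀ n → ∑ n (λ _ → 0ℤ) ≡ 0ℤ
∑-zero n = trans (∑-const n 0ℤ) (ℤ.*-zeroʳ (ℤ.+ n))

∑-δ : ∀ n t (f : ℕ → ℤ) → t < n → ∑ n (λ v → δ v t ℤ.* f v) ≡ f t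
∑-δ (suc n) zero    f _ = begin
  1ℤ ℤ.* f 0 ℤ.+ ∑ n (λ v → 0ℤ ℤ.* f (suc v)) ≡⟨ cong₂ ℤ._+_ (ℤ.*-identityˡ (f 0)) (∑-zero n) ⟩
  f 0 ℤ.+ 0ℤ                                 ≡⟨ ℤ.+-identityʳ (f 0) ⟩
  f 0                                        ∎
∑-δ (suc n) (suc t) f (s≤s t<n) = trans (ℤ.+-identityˡ _) (∑-δ n t (f ∘ suc) t<n)

∣-transˡ-- : ∀ {m} x y z → m ∣ₛ x ℤ.- y → m ∣ₛ y ℤ.- z → m ∣ₛ x ℤ.- z
∣-transˡ-- x y z m∣ m∣′ = subst (_ ∣ₛ_) (ring x y z) (ℤ∣.∣m∣n⇒∣m+n m∣ m∣′)
  where ring : ∀ x y z → x ℤ.- y ℤ.+ (y ℤ.- z) ≡ x ℤ.- z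
        ring = solve-∀

∣-sym-- : ∀ {m} x y → m ∣ₛ x ℤ.- y → m ∣ₛ y ℤ.- x
∣-sym-- x y m∣ = subst (_ ∣ₛ_) (ring x y) (ℤ∣.∣m⇒∣-m m∣)
  where ring : ∀ x y → ℤ.- (x ℤ.- y) ≡ y ℤ.- x
        ring = solve-∀

∣-refl-- : ∀ {m} x → m ∣ₛ x ℤ.- x
∣-refl-- x = ℤ∣.divides 0ℤ (ℤ.+-inverseʳ x)

module Kernel (p″ : ℕ) (p-prime : Prime (2+ p″)) (α : ℕ) (F : ℕ → ℤ) where

  open PrimePower p″ p-prime

  -- The entry of the product of `A (p ^ α)` with `F` belonging to a codomain basis element;
  -- addressing rows by basis elements lets membership replace positions.
  row : ℕ × ℕ → ℤ
  row (d , e) = ∑ (p ^ α) (λ c → coeff (X^ c modₚ Φ d) e ℤ.* F c)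

  -- The coefficients of F reduced modulo X^(p^i) - 1.
  G : ℕ → ℕ → ℤ
  G i t = ∑ (p ^ (α ∸ i)) (λ u → F (u * p ^ i + t))

  p^α≡ : ∀ {i} → i ≤ α → p ^ α ≡ p ^ (α ∸ i) * p ^ i
  p^α≡ {i} i≤α = trans (cong (p ^_) (sym (m∸n+n≡m i≤α))) (^-distribˡ-+-* p (α ∸ i) i)

  row-1 : row (1 , 0) ≡ G 0 0
  row-1 = ∑-cong (p ^ α) λ c _ → trans (cong (ℤ._* F c) (coeff-X^-mod-Φ1 c))
    (trans (ℤ.*-identityˡ (F c)) (cong F (sym (trans (+-identityʳ (c * 1)) (*-identityʳ c)))))

  p′*p^i+<p^ : ∀ i {t} → t < p ^ i → p′ * p ^ i + t < p ^ suc i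
  p′*p^i+<p^ i {t} t< = subst (p′ * p ^ i + t <_) (+-comm (p′ * p ^ i) (p ^ i)) (+-monoʳ-< (p′ * p ^ i) t<)

  -- The remainder of X^c depends only on c modulo p^(i+1), so summing over each residue class turns
  -- `F` into `G (suc i)`. The subtracted position is the one congruent to `e` in the last block of
  -- length p^i.
  row-p^ : ∀ i e → i < α → e < p′ * p ^ i →
           row (p ^ suc i , e) ≡ G (suc i) e ℤ.- G (suc i) (p′ * p ^ i + e %p^ i)
  row-p^ i e i<α e<D = begin
    ∑ (p ^ α) (λ c → coeff (X^ c modₚ Φ K) e ℤ.* F c)
      ≡⟨ ∑-cong (p ^ α) (λ c _ → cong (ℤ._* F c) (coeff-X^-mod-Φp^ i c e e<D)) ⟩
    ∑ (p ^ α) (λ c → f (c %p^ suc i) c)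
      ≡⟨ cong (λ n → ∑ n (λ c → f (c %p^ suc i) c)) (p^α≡ i<α) ⟩
    ∑ (p ^ (α ∸ suc i) * K) (λ c → f (c %p^ suc i) c)
      ≡⟨ ∑-* (p ^ (α ∸ suc i)) K (λ c → f (c %p^ suc i) c) ⟩
    ∑ (p ^ (α ∸ suc i)) (λ u → ∑ K (λ v → f ((u * K + v) %p^ suc i) (u * K + v)))
      ≡⟨ ∑-cong (p ^ (α ∸ suc i)) (λ u _ → inner u) ⟩
    ∑ (p ^ (α ∸ suc i)) (λ u → F (u * K + e) ℤ.- F (u * K + e′))
      ≡⟨ ∑-distrib-- (p ^ (α ∸ suc i)) (λ u → F (u * K + e)) (λ u → F (u * K + e′)) ⟩
    G (suc i) e ℤ.- G (suc i) e′
      ∎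
    where
    K = p ^ suc i
    e′ = p′ * p ^ i + e %p^ i
    f : ℕ → ℕ → ℤ
    f v c = (δ v e ℤ.- δ v e′) ℤ.* F c
    residue : ∀ u v → v < K → (u * K + v) %p^ suc i ≡ v
    residue u v v<K = trans (%-remove-+ˡ v {{m^n≢0 p (suc i)}} (n∣m*n u)) (m<n⇒m%n≡m {{m^n≢0 p (suc i)}} v<K)
    ring : ∀ a b c → (a ℤ.- b) ℤ.* c ≡ a ℤ.* c ℤ.- b ℤ.* c
    ring = solve-∀
    inner : ∀ u → ∑ K (λ v → f ((u * K + v) %p^ suc i) (u * K + v)) ≡ F (u * K + e) ℤ.- F (u * K + e′)
    inner u = begin
      ∑ K (λ v → f ((u * K + v) %p^ suc i) (u * K + v))
        ≡⟨ ∑-cong K (λ v v<K → trans (cong (λ w → f w (u * K + v)) (residue u v v<K))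
             (ring (δ v e) (δ v e′) (F (u * K + v)))) ⟩
      ∑ K (λ v → δ v e ℤ.* F (u * K + v) ℤ.- δ v e′ ℤ.* F (u * K + v))
        ≡⟨ ∑-distrib-- K (λ v → δ v e ℤ.* F (u * K + v)) (λ v → δ v e′ ℤ.* F (u * K + v)) ⟩
      ∑ K (λ v → δ v e ℤ.* F (u * K + v)) ℤ.- ∑ K (λ v → δ v e′ ℤ.* F (u * K + v))
        ≡⟨ cong₂ ℤ._-_ (∑-δ K e (λ v → F (u * K + v)) (<-≤-trans e<D (m≤n+m (p′ * p ^ i) (p ^ i))))
                       (∑-δ K e′ (λ v → F (u * K + v)) (p′*p^i+<p^ i (%p^-< e i))) ⟩
      F (u * K + e) ℤ.- F (u * K + e′)
        ∎

  -- A class modulo p^i is the union of p classes modulo p^(i+1).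
  G-suc : ∀ i t → i < α → G i t ≡ ∑ p (λ b → G (suc i) (b * p ^ i + t))
  G-suc i t i<α = begin
    ∑ (p ^ (α ∸ i)) f
      ≡⟨ cong (λ n → ∑ n f) (trans (cong (p ^_) (+-∸-assoc 1 i<α)) (*-comm p (p ^ (α ∸ suc i)))) ⟩
    ∑ (p ^ (α ∸ suc i) * p) f
      ≡⟨ ∑-* (p ^ (α ∸ suc i)) p f ⟩
    ∑ (p ^ (α ∸ suc i)) (λ u → ∑ p (λ b → f (u * p + b)))
      ≡⟨ ∑-comm (p ^ (α ∸ suc i)) p (λ u b → f (u * p + b)) ⟩
    ∑ p (λ b → ∑ (p ^ (α ∸ suc i)) (λ u → f (u * p + b)))
      ≡⟨ ∑-cong p (λ b _ → ∑-cong (p ^ (α ∸ suc i)) (λ u _ → cong F (ring u p b (p ^ i) t))) ⟩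
    ∑ p (λ b → G (suc i) (b * p ^ i + t))
      ∎
    where
    f : ℕ → ℤ
    f u = F (u * p ^ i + t)
    ring : ∀ u p b m t → (u * p + b) * m + t ≡ u * (p * m) + (b * m + t)
    ring = ℕ-Solver.solve-∀

  module _ (M : ℤ) (M∣row : ∀ {x} → x ∈ codomainBasis (p ^ α) → M ∣ₛ row x) where

    M∣G : M ∣ₛ G 0 0
    M∣G = subst (M ∣ₛ_) row-1 (M∣row (∈-codomainBasis⁺ {α} {0} z≤n (s≤s z≤n)))

    private
      G≡last : ∀ {i} b t → i < α → b < p → t < p ^ i →
               M ∣ₛ G (suc i) (b * p ^ i + t) ℤ.- G (suc i) (p′ * p ^ i + t)
      G≡last {i} b t i<α b<p t< with m≤n⇒m<n∨m≡n (s≤s⁻¹ b<p)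
      -- No row has its position in the last block, since e < φ(p^(i+1)); there the difference is
      -- zero anyway.
      ... | inj₂ refl = ∣-refl-- (G (suc i) (p′ * p ^ i + t))
      ... | inj₁ b<p′ = subst (λ t′ → M ∣ₛ G (suc i) e ℤ.- G (suc i) (p′ * p ^ i + t′)) e%
        (subst (M ∣ₛ_) (row-p^ i e i<α e<D)
          (M∣row (∈-codomainBasis⁺ {α} {suc i} i<α (subst (e <_) (sym (φ-p^ i)) e<D))))
        where
        e = b * p ^ i + t
        e<D : e < p′ * p ^ i
        e<D = <-≤-trans (+-monoʳ-< (b * p ^ i) t<)
          (≤-trans (≤-reflexive (+-comm (b * p ^ i) (p ^ i))) (*-monoˡ-≤ (p ^ i) b<p′))
        e% : e %p^ i ≡ t
        e% = trans (%-remove-+ˡ t {{m^n≢0 p i}} (n∣m*n b)) (m<n⇒m%n≡m {{m^n≢0 p i}} t<)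

    G-periodic : ∀ {i} b t → i < α → b < p → t < p ^ i → M ∣ₛ G (suc i) (b * p ^ i + t) ℤ.- G (suc i) t
    G-periodic {i} b t i<α b<p t< = ∣-transˡ-- (G (suc i) (b * p ^ i + t)) (G (suc i) (p′ * p ^ i + t)) _
      (G≡last b t i<α b<p t<)
      (∣-sym-- (G (suc i) t) _ (G≡last 0 t i<α (s≤s z≤n) t<))

    -- Induction downwards from level α, where `G` is `F`: by `G-suc` and periodicity, each level
    -- below is p times the one above it.
    G≡p^jF : ∀ j {i} t → i + j ≡ α → t < p ^ i → M ∣ₛ G i t ℤ.- ℤ.+ (p ^ j) ℤ.* F t
    G≡p^jF zero    {i} t i+0≡α t< = subst (λ x → M ∣ₛ x ℤ.- 1ℤ ℤ.* F t) (sym G≡F)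
      (subst (λ x → M ∣ₛ F t ℤ.- x) (sym (ℤ.*-identityˡ (F t))) (∣-refl-- (F t)))
      where
      G≡F : G i t ≡ F t
      G≡F with refl ← trans (sym (+-identityʳ i)) i+0≡α rewrite n∸n≡0 i = ℤ.+-identityʳ (F t)
    G≡p^jF (suc j) {i} t i+sj≡α t< = ∣-transˡ-- (G i t) (ℤ.+ p ℤ.* G (suc i) t) _
      (subst (M ∣ₛ_) sum-eq (∑-∣ p (λ b → G (suc i) (b * p ^ i + t) ℤ.- G (suc i) t)
        (λ b b<p → G-periodic b t i<α b<p t<)))
      (subst (M ∣ₛ_) prod-eq (ℤ∣.∣n⇒∣m*n (ℤ.+ p) (G≡p^jF j t (trans (sym (+-suc i j)) i+sj≡α) (<-trans t< (p^-mono-< (n<1+n i))))))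
      where
      i<α : i < α
      i<α = subst (i <_) i+sj≡α (m<m+n i (s≤s z≤n))
      sum-eq : ∑ p (λ b → G (suc i) (b * p ^ i + t) ℤ.- G (suc i) t) ≡ G i t ℤ.- ℤ.+ p ℤ.* G (suc i) t
      sum-eq = trans (∑-distrib-- p (λ b → G (suc i) (b * p ^ i + t)) (λ _ → G (suc i) t))
        (cong₂ ℤ._-_ (sym (G-suc i t i<α)) (∑-const p (G (suc i) t)))
      ring : ∀ a g b f → a ℤ.* (g ℤ.- b ℤ.* f) ≡ a ℤ.* g ℤ.- (a ℤ.* b) ℤ.* f
      ring = solve-∀
      prod-eq : ℤ.+ p ℤ.* (G (suc i) t ℤ.- ℤ.+ (p ^ j) ℤ.* F t) ≡ ℤ.+ p ℤ.* G (suc i) t ℤ.- ℤ.+ (p ^ suc j) ℤ.* F t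
      prod-eq = trans (ring (ℤ.+ p) (G (suc i) t) (ℤ.+ (p ^ j)) (F t))
        (cong (λ x → ℤ.+ p ℤ.* G (suc i) t ℤ.- x ℤ.* F t) (sym (ℤ.pos-* p (p ^ j))))

    -- `J` counts the levels from α down to `i`. At each level the residue c′ modulo p^(i+1) sits at
    -- offset t in block b; periodicity of `G (suc i)` together with `G≡p^jF` gives a congruence
    -- modulo `M` between p^J F(c′) and p^J F(t), from which `cancel` removes the power of p.
    F-periodic : ∀ q J {i} → i + J ≡ α → (∀ j → j < J → ∀ x → M ∣ₛ ℤ.+ (p ^ j) ℤ.* x → q ∣ₛ x) →
                 ∀ c → c < p ^ α → q ∣ₛ F c ℤ.- F (c %p^ i)
    F-periodic q zero    {i} i+0≡α cancel c c<
      with refl ← trans (sym (+-identityʳ i)) i+0≡α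
      rewrite m<n⇒m%n≡m {{m^n≢0 p i}} c< = ∣-refl-- (F c)
    F-periodic q (suc J) {i} i+sJ≡α cancel c c< = ∣-transˡ-- (F c) (F c′) (F t)
      (F-periodic q J si+J≡α (λ j j<J → cancel j (m<n⇒m<1+n j<J)) c c<)
      (cancel J (n<1+n J) (F c′ ℤ.- F t) (subst (M ∣ₛ_) (ring (ℤ.+ (p ^ J)) (F c′) (F t))
        (∣-transˡ-- (ℤ.+ (p ^ J) ℤ.* F c′) (G (suc i) c′) _
          (∣-sym-- (G (suc i) c′) _ (G≡p^jF J c′ si+J≡α c′<))
          (∣-transˡ-- (G (suc i) c′) (G (suc i) t) _
            (subst (λ x → M ∣ₛ G (suc i) x ℤ.- G (suc i) t) (sym c′≡)
              (G-periodic b t i<α b<p (%p^-< c i)))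
            (G≡p^jF J t si+J≡α (<-trans (%p^-< c i) (p^-mono-< (n<1+n i))))))))
      where
      instance
        _ = m^n≢0 p i
        _ = m^n≢0 p (suc i)
      si+J≡α : suc i + J ≡ α
      si+J≡α = trans (sym (+-suc i J)) i+sJ≡α
      i<α : i < α
      i<α = subst (i <_) i+sJ≡α (m<m+n i (s≤s z≤n))
      c′ t b : ℕ
      c′ = c %p^ suc i
      t  = c %p^ i
      b  = c′ / p ^ i
      c′< : c′ < p ^ suc i
      c′< = %p^-< c (suc i)
      b<p : b < p
      b<p = m<n*o⇒m/o<n c′<
      c′≡ : c′ ≡ b * p ^ i + t
      c′≡ = trans (m≡m%n+[m/n]*n c′ (p ^ i)) (trans (+-comm (c′ % p ^ i) _)
        (cong (_+_ (b * p ^ i)) (m∣n⇒o%n%m≡o%m (p ^ i) (p ^ suc i) c (n∣m*n p))))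
      ring : ∀ a x y → a ℤ.* x ℤ.- a ℤ.* y ≡ a ℤ.* (x ℤ.- y)
      ring = solve-∀

    -- Descending to level 0 makes `F` constant modulo `q`; the row of Φ_1 then kills the constant,
    -- because `G 0 0` is p^α F(0) modulo `M`.
    F≡0 : ∀ q → (∀ j → j ≤ α → ∀ x → M ∣ₛ ℤ.+ (p ^ j) ℤ.* x → q ∣ₛ x) → ∀ c → c < p ^ α → q ∣ₛ F c
    F≡0 q cancel c c< = subst (q ∣ₛ_) (ring (F c) (F 0)) (ℤ∣.∣m∣n⇒∣m+n q∣Fc-F0 q∣F0)
      where
      ring : ∀ x y → x ℤ.- y ℤ.+ y ≡ x
      ring = solve-∀
      ring′ : ∀ x y → ℤ.- (x ℤ.- y) ℤ.+ x ≡ y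
      ring′ = solve-∀
      q∣Fc-F0 : q ∣ₛ F c ℤ.- F 0
      q∣Fc-F0 = subst (λ t → q ∣ₛ F c ℤ.- F t) (n%1≡0 c)
        (F-periodic q α {0} refl (λ j j<α → cancel j (<⇒≤ j<α)) c c<)
      q∣F0 : q ∣ₛ F 0
      q∣F0 = cancel α ≤-refl (F 0) (subst (M ∣ₛ_) (ring′ (G 0 0) _)
        (ℤ∣.∣m∣n⇒∣m+n (ℤ∣.∣m⇒∣-m (G≡p^jF α {0} 0 refl (s≤s z≤n))) M∣G))

  module _ (s e : ℕ) (s+e≡α : s + e ≡ α) (F-per : ∀ c c′ → c %p^ s ≡ c′ %p^ s → F c ≡ F c′) where

    private
      p^e∣G : ∀ i t → i ≤ s → ℤ.+ (p ^ e) ∣ₛ G i t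
      p^e∣G i t i≤s = ℤ∣.divides (∑ (p ^ (s ∸ i)) f) (begin
        ∑ (p ^ (α ∸ i)) f
          ≡⟨ cong (λ n → ∑ n f) (trans (cong (p ^_) α∸i) (^-distribˡ-+-* p e (s ∸ i))) ⟩
        ∑ (p ^ e * p ^ (s ∸ i)) f
          ≡⟨ ∑-* (p ^ e) (p ^ (s ∸ i)) f ⟩
        ∑ (p ^ e) (λ u → ∑ (p ^ (s ∸ i)) (λ v → f (u * p ^ (s ∸ i) + v)))
          ≡⟨ ∑-cong (p ^ e) (λ u _ → ∑-cong (p ^ (s ∸ i)) (λ v _ → F-per _ _ (residue u v))) ⟩
        ∑ (p ^ e) (λ _ → ∑ (p ^ (s ∸ i)) f)
          ≡⟨ ∑-const (p ^ e) (∑ (p ^ (s ∸ i)) f) ⟩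
        ℤ.+ (p ^ e) ℤ.* ∑ (p ^ (s ∸ i)) f
          ≡⟨ ℤ.*-comm (ℤ.+ (p ^ e)) _ ⟩
        ∑ (p ^ (s ∸ i)) f ℤ.* ℤ.+ (p ^ e)
          ∎)
        where
        f : ℕ → ℤ
        f u = F (u * p ^ i + t)
        α∸i : α ∸ i ≡ e + (s ∸ i)
        α∸i = trans (cong (_∸ i) (trans (sym s+e≡α) (+-comm s e))) (+-∸-assoc e i≤s)
        ring : ∀ u a v b t → (u * a + v) * b + t ≡ u * (a * b) + (v * b + t)
        ring = ℕ-Solver.solve-∀
        residue : ∀ u v → ((u * p ^ (s ∸ i) + v) * p ^ i + t) %p^ s ≡ (v * p ^ i + t) %p^ s
        residue u v = trans (cong (_%p^ s) (trans (ring u (p ^ (s ∸ i)) v (p ^ i) t)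
            (cong (λ x → u * x + (v * p ^ i + t))
              (trans (sym (^-distribˡ-+-* p (s ∸ i) i)) (cong (p ^_) (m∸n+n≡m i≤s))))))
          (%-remove-+ˡ (v * p ^ i + t) {{m^n≢0 p s}} (n∣m*n u))

      G-const : ∀ i t → s ≤ i → G (suc i) t ≡ G (suc i) (p′ * p ^ i + t %p^ i)
      G-const i t s≤i = ∑-cong (p ^ (α ∸ suc i)) (λ u _ → F-per _ _ (reduce (trans (lhs u) (sym (rhs u)))))
        where
        instance
          _ = m^n≢0 p i
          _ = m^n≢0 p s
        p^s∣p^i : p ^ s ∣ℕ p ^ i
        p^s∣p^i = divides (p ^ (i ∸ s))
          (trans (cong (p ^_) (sym (m∸n+n≡m s≤i))) (^-distribˡ-+-* p (i ∸ s) s))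
        reduce : ∀ {c c′} → c %p^ i ≡ c′ %p^ i → c %p^ s ≡ c′ %p^ s
        reduce {c} {c′} eq = trans (sym (m∣n⇒o%n%m≡o%m (p ^ s) (p ^ i) c p^s∣p^i))
          (trans (cong (_%p^ s) eq) (m∣n⇒o%n%m≡o%m (p ^ s) (p ^ i) c′ p^s∣p^i))
        lhs : ∀ u → (u * p ^ suc i + t) %p^ i ≡ t %p^ i
        lhs u = %-remove-+ˡ t (∣n⇒∣m*n u (n∣m*n p))
        rhs : ∀ u → (u * p ^ suc i + (p′ * p ^ i + t %p^ i)) %p^ i ≡ t %p^ i
        rhs u = trans (%-remove-+ˡ _ (∣n⇒∣m*n u (n∣m*n p)))
          (trans (%-remove-+ˡ (t %p^ i) (n∣m*n p′)) (m<n⇒m%n≡m (%p^-< t i)))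

    -- Up to level s, each `G` sums a p^s-periodic function over p^e full periods; beyond it, `G` is
    -- itself p^s-periodic and the two terms of the row are equal.
    p^e∣row : ∀ {x} → x ∈ codomainBasis (p ^ α) → ℤ.+ (p ^ e) ∣ₛ row x
    p^e∣row x∈ with ∈-codomainBasis⁻ {α} x∈
    ... | zero  , _ , refl , s≤s z≤n = subst (_ ∣ₛ_) (sym row-1) (p^e∣G 0 0 z≤n)
    ... | suc i , i<α , refl , e<φ with i <? s
    ... | yes i<s = subst (_ ∣ₛ_) (sym (row-p^ i _ i<α (subst (_ <_) (φ-p^ i) e<φ)))
      (ℤ∣.∣m∣n⇒∣m-n (p^e∣G (suc i) _ i<s) (p^e∣G (suc i) _ i<s))
    ... | no i≮s  = subst (_ ∣ₛ_) (sym (row-p^ i _ i<α (subst (_ <_) (φ-p^ i) e<φ)))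
      (subst (λ x → _ ∣ₛ G (suc i) _ ℤ.- x) (G-const i _ (≮⇒≥ i≮s)) (∣-refl-- (G (suc i) _)))

-- Diagonal entries divisible by a given number

infixr 7 _·ᵥ_
_·ᵥ_ : ∀ {m n} → Matrix m n → Vector ℤ n → Vector ℤ m
(B ·ᵥ v) i = Sum.sum (λ k → B i k ℤ.* v k)

sum-zero : ∀ n → Sum.sum {n} (λ _ → 0ℤ) ≡ 0ℤ
sum-zero n = Sum.sum-replicate-zero n

·ᵥ-congʳ : ∀ {m n} (B : Matrix m n) {v w} → v ≗ w → B ·ᵥ v ≗ B ·ᵥ w
·ᵥ-congʳ B v≗w i = Sum.sum-cong-≗ (λ k → cong (B i k ℤ.*_) (v≗w k))

·ᵥ-congˡ : ∀ {m n} {B C : Matrix m n} → B ≈ₘ C → ∀ v → B ·ᵥ v ≗ C ·ᵥ v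
·ᵥ-congˡ B≈C v i = Sum.sum-cong-≗ (λ k → cong (ℤ._* v k) (B≈C i k))

*ₘ-·ᵥ : ∀ {l m n} (B : Matrix l m) (C : Matrix m n) v → (B *ₘ C) ·ᵥ v ≗ B ·ᵥ C ·ᵥ v
*ₘ-·ᵥ B C v i = begin
  Sum.sum (λ k → Sum.sum (λ j → B i j ℤ.* C j k) ℤ.* v k)
    ≡⟨ Sum.sum-cong-≗ (λ k → Sum.*-distribʳ-sum (v k) (λ j → B i j ℤ.* C j k)) ⟩
  Sum.sum (λ k → Sum.sum (λ j → B i j ℤ.* C j k ℤ.* v k))
    ≡⟨ Sum.∑-comm (λ k j → B i j ℤ.* C j k ℤ.* v k) ⟩
  Sum.sum (λ j → Sum.sum (λ k → B i j ℤ.* C j k ℤ.* v k))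
    ≡⟨ Sum.sum-cong-≗ (λ j → Sum.sum-cong-≗ (λ k → ℤ.*-assoc (B i j) (C j k) (v k))) ⟩
  Sum.sum (λ j → Sum.sum (λ k → B i j ℤ.* (C j k ℤ.* v k)))
    ≡⟨ Sum.sum-cong-≗ (λ j → Sum.*-distribˡ-sum (B i j) (λ k → C j k ℤ.* v k)) ⟨
  (B ·ᵥ C ·ᵥ v) i
    ∎

sum-single : ∀ {n} i (f : Vector ℤ n) → (∀ j → i ≢ j → f j ≡ 0ℤ) → Sum.sum f ≡ f i
sum-single {suc n} zero    f h =
  trans (cong (λ x → f zero ℤ.+ x) (trans (Sum.sum-cong-≗ (λ j → h (suc j) λ ())) (sum-zero n))) (ℤ.+-identityʳ _)
sum-single {suc n} (suc i) f h =
  trans (cong₂ ℤ._+_ (h zero λ ()) (sum-single i (f ∘ suc) (λ j i≢j → h (suc j) (i≢j ∘ Fin.suc-injective))))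
    (ℤ.+-identityˡ _)

1ₘ-·ᵥ : ∀ {n} (v : Vector ℤ n) → 1ₘ ·ᵥ v ≗ v
1ₘ-·ᵥ v i = trans (sum-single i _ off) on
  where
  off : ∀ j → i ≢ j → 1ₘ i j ℤ.* v j ≡ 0ℤ
  off j i≢j with i Fin.≟ j
  ... | yes i≡j = contradiction i≡j i≢j
  ... | no  _   = refl
  on : 1ₘ i i ℤ.* v i ≡ v i
  on with i Fin.≟ i
  ... | yes _   = ℤ.*-identityˡ (v i)
  ... | no  i≢i = contradiction refl i≢i

diagonal-·ᵥ : ∀ {n} {S : Matrix n n} → IsDiagonal S → ∀ v i → (S ·ᵥ v) i ≡ S i i ℤ.* v i
diagonal-·ᵥ diag v i =
  sum-single i _ (λ j i≢j → cong (ℤ._* v j) (diag i j (i≢j ∘ toℕ-injective)))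

·ᵥ-- : ∀ {m n} (B : Matrix m n) v w i → (B ·ᵥ (λ k → v k ℤ.- w k)) i ≡ (B ·ᵥ v) i ℤ.- (B ·ᵥ w) i
·ᵥ-- {n = n} B v w i = go (B i) v w
  where
  ring : ∀ b v w s t → b ℤ.* (v ℤ.- w) ℤ.+ (s ℤ.- t) ≡ b ℤ.* v ℤ.+ s ℤ.- (b ℤ.* w ℤ.+ t)
  ring = solve-∀
  go : ∀ {n} (b v w : Vector ℤ n) → Sum.sum (λ k → b k ℤ.* (v k ℤ.- w k)) ≡
       Sum.sum (λ k → b k ℤ.* v k) ℤ.- Sum.sum (λ k → b k ℤ.* w k)
  go {zero}  b v w = refl
  go {suc n} b v w = trans (cong (λ x → b zero ℤ.* (v zero ℤ.- w zero) ℤ.+ x) (go (b ∘ suc) (v ∘ suc) (w ∘ suc)))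
    (ring (b zero) (v zero) (w zero) _ _)

∣-·ᵥ : ∀ {m n d} (B : Matrix m n) {v} → (∀ k → d ∣ₛ v k) → ∀ i → d ∣ₛ (B ·ᵥ v) i
∣-·ᵥ {d = d} B {v} d∣v i = go (λ k → ℤ∣.∣n⇒∣m*n (B i k) (d∣v k))
  where
  go : ∀ {n} {f : Vector ℤ n} → (∀ k → d ∣ₛ f k) → d ∣ₛ Sum.sum f
  go {zero}  h = ℤ∣.divides 0ℤ refl
  go {suc n} h = ℤ∣.∣m∣n⇒∣m+n (h zero) (go (h ∘ suc))

-- Comparing dimensions modulo p by counting residue vectors

funToFin-cong : ∀ {m n} {f g : Fin m → Fin n} → f ≗ g → funToFin f ≡ funToFin g
funToFin-cong {zero}  f≗g = refl
funToFin-cong {suc m} f≗g = cong₂ combine (f≗g zero) (funToFin-cong (f≗g ∘ suc))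

∣∸⇒≥ : ∀ {p a b} → b < p → p ∣ℕ b ∸ a → b ≤ a
∣∸⇒≥ {p} {a} {b} b<p p∣b∸a with b ∸ a in eq
... | zero  = m∸n≡0⇒m≤n eq
... | suc d = contradiction (∣⇒≤ p∣b∸a) (<⇒≱ (≤-<-trans (≤-trans (≤-reflexive (sym eq)) (m∸n≤m b a)) b<p))

∣toℕ-toℕ⇒≡ : ∀ {p} (i j : Fin p) → ℤ.+ p ∣ₛ ℤ.+ toℕ i ℤ.- ℤ.+ toℕ j → i ≡ j
∣toℕ-toℕ⇒≡ {p} i j p∣ = toℕ-injective (go (≤-total (toℕ i) (toℕ j)))
  where
  p∣⊖ : p ∣ℕ ∣ toℕ i ℤ.⊖ toℕ j ∣
  p∣⊖ = subst (λ x → p ∣ℕ ∣ x ∣) (ℤ.m-n≡m⊖n (toℕ i) (toℕ j)) (∣⇒∣ᵤ p∣)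
  go : toℕ i ≤ toℕ j ⊎ toℕ j ≤ toℕ i → toℕ i ≡ toℕ j
  go (inj₁ i≤j) = ≤-antisym i≤j (∣∸⇒≥ (toℕ<n j) (subst (p ∣ℕ_) (ℤ.∣⊖∣-≤ i≤j) p∣⊖))
  go (inj₂ j≤i) = ≤-antisym (∣∸⇒≥ (toℕ<n i)
    (subst (p ∣ℕ_) (trans (ℤ.∣m⊖n∣≡∣n⊖m∣ (toℕ i) (toℕ j)) (ℤ.∣⊖∣-≤ j≤i)) p∣⊖)) j≤i

-- Such a T embeds 𝔽_p^a into 𝔽_p^b, so that p^a ≤ p^b.
injective-mod-p⇒≤ : ∀ {p} → 1 < p → ∀ {a b} (T : Vector ℤ a → Vector ℤ b) →
  (∀ x y t → T (λ u → x u ℤ.- y u) t ≡ T x t ℤ.- T y t) →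
  (∀ x → (∀ t → ℤ.+ p ∣ₛ T x t) → ∀ u → ℤ.+ p ∣ₛ x u) → a ≤ b
injective-mod-p⇒≤ {p@(suc _)} 1<p {a} {b} T T-- ker =
  ≮⇒≥ (λ b<a → <⇒≱ (^-monoʳ-< p 1<p b<a) (injective⇒≤ f-injective))
  where
  -- The base p digits of an index, as integer representatives of a vector over 𝔽_p; `f` applies `T`
  -- to them and reduces modulo p.
  lift : Fin (p ^ a) → Vector ℤ a
  lift i u = ℤ.+ toℕ (finToFun {p} {a} i u)

  f : Fin (p ^ a) → Fin (p ^ b)
  f i = funToFin (λ t → fromℕ< (n%ℕd<d (T (lift i) t) p))

  f-injective : ∀ {i j} → f i ≡ f j → i ≡ j
  f-injective {i} {j} fi≡fj = begin
    i                                ≡⟨ funToFin-finToFin {a} {p} i ⟨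
    funToFin (finToFun {p} {a} i)    ≡⟨ funToFin-cong (λ u → ∣toℕ-toℕ⇒≡ _ _ (ker _ p∣T u)) ⟩
    funToFin (finToFun {p} {a} j)    ≡⟨ funToFin-finToFin {a} {p} j ⟩
    j                                ∎
    where
    residue≡ : ∀ t → T (lift i) t ℤ.%ℕ p ≡ T (lift j) t ℤ.%ℕ p
    residue≡ t = begin
      T (lift i) t ℤ.%ℕ p                             ≡⟨ toℕ-fromℕ< (n%ℕd<d (T (lift i) t) p) ⟨
      toℕ (fromℕ< (n%ℕd<d (T (lift i) t) p))        ≡⟨ cong toℕ (finToFun-funToFin _ t) ⟨
      toℕ (finToFun (f i) t)                        ≡⟨ cong (λ x → toℕ (finToFun x t)) fi≡fj ⟩
      toℕ (finToFun (f j) t)                        ≡⟨ cong toℕ (finToFun-funToFin _ t) ⟩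
      toℕ (fromℕ< (n%ℕd<d (T (lift j) t) p))        ≡⟨ toℕ-fromℕ< (n%ℕd<d (T (lift j) t) p) ⟩
      T (lift j) t ℤ.%ℕ p                             ∎

    p∣T : ∀ t → ℤ.+ p ∣ₛ T (λ u → lift i u ℤ.- lift j u) t
    p∣T t = ℤ∣.divides (x ℤ./ℕ p ℤ.- y ℤ./ℕ p) (begin
      T (λ u → lift i u ℤ.- lift j u) t
        ≡⟨ T-- (lift i) (lift j) t ⟩
      x ℤ.- y
        ≡⟨ cong₂ ℤ._-_ (a≡a%ℕn+[a/ℕn]*n x p) (a≡a%ℕn+[a/ℕn]*n y p) ⟩
      (ℤ.+ (x ℤ.%ℕ p) ℤ.+ x ℤ./ℕ p ℤ.* ℤ.+ p) ℤ.- (ℤ.+ (y ℤ.%ℕ p) ℤ.+ y ℤ./ℕ p ℤ.* ℤ.+ p)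
        ≡⟨ cong (λ r → (ℤ.+ r ℤ.+ x ℤ./ℕ p ℤ.* ℤ.+ p) ℤ.- (ℤ.+ (y ℤ.%ℕ p) ℤ.+ y ℤ./ℕ p ℤ.* ℤ.+ p)) (residue≡ t) ⟩
      (ℤ.+ (y ℤ.%ℕ p) ℤ.+ x ℤ./ℕ p ℤ.* ℤ.+ p) ℤ.- (ℤ.+ (y ℤ.%ℕ p) ℤ.+ y ℤ./ℕ p ℤ.* ℤ.+ p)
        ≡⟨ ring (ℤ.+ (y ℤ.%ℕ p)) (x ℤ./ℕ p) (y ℤ./ℕ p) (ℤ.+ p) ⟩
      (x ℤ./ℕ p ℤ.- y ℤ./ℕ p) ℤ.* ℤ.+ p
        ∎)
      where
      x = T (lift i) t
      y = T (lift j) t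
      ring : ∀ r a b p → (r ℤ.+ a ℤ.* p) ℤ.- (r ℤ.+ b ℤ.* p) ≡ (a ℤ.- b) ℤ.* p
      ring = solve-∀

lookup-injective : ∀ {A : Set} {xs : List A} → Unique xs → ∀ i j → lookup xs i ≡ lookup xs j → i ≡ j
lookup-injective (x≢ ∷ _)  zero    zero    _  = refl
lookup-injective (x≢ ∷ _)  zero    (suc j) eq = contradiction eq (All.lookup x≢ (∈-lookup j))
lookup-injective (x≢ ∷ _)  (suc i) zero    eq = contradiction (sym eq) (All.lookup x≢ (∈-lookup i))
lookup-injective (_ ∷ xs!) (suc i) (suc j) eq = cong suc (lookup-injective xs! i j eq)

length-filter-map : ∀ {A B : Set} {P : B → Set} (P? : Decidable P) (f : A → B) xs →
                    length (filter P? (map f xs)) ≡ length (filter (P? ∘ f) xs)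
length-filter-map P? f []       = refl
length-filter-map P? f (x ∷ xs) with P? (f x)
... | yes _ = cong suc (length-filter-map P? f xs)
... | no  _ = length-filter-map P? f xs

diagonal-square : ∀ {n} (S : Matrix n n) → diagonal S ≡ tabulate (λ i → S i i)
diagonal-square {zero}  S = refl
diagonal-square {suc n} S = cong (S zero zero ∷_) (diagonal-square (λ i j → S (suc i) (suc j)))

-- Counting diagonal entries through the kernel modulo M

infix 4 _∣abs?_
_∣abs?_ : ∀ M (x : ℤ) → Dec (ℤ.+ M ∣ x)
M ∣abs? x = M ∣? ∣ x ∣

countMultiples : ℕ → List ℤ → ℕ
countMultiples M xs = length (filter (M ∣abs?_) xs)

module SmithCount {k : ℕ} (B S : Matrix k k) (snf : IsSmithNormalForm B S) where

  open IsSmithNormalForm snf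

  private
    equivalent-·ᵥ : ∀ v → U ·ᵥ B ·ᵥ V ·ᵥ v ≗ S ·ᵥ v
    equivalent-·ᵥ v i = begin
      (U ·ᵥ B ·ᵥ V ·ᵥ v) i     ≡⟨ *ₘ-·ᵥ U B (V ·ᵥ v) i ⟨
      ((U *ₘ B) ·ᵥ V ·ᵥ v) i   ≡⟨ *ₘ-·ᵥ (U *ₘ B) V v i ⟨
      ((U *ₘ B *ₘ V) ·ᵥ v) i   ≡⟨ ·ᵥ-congˡ equivalent v i ⟩
      (S ·ᵥ v) i               ∎

    cancel-inverse : ∀ {n} (C D : Matrix n n) → C *ₘ D ≈ₘ 1ₘ → ∀ v → C ·ᵥ D ·ᵥ v ≗ v
    cancel-inverse C D CD≈1 v i =
      trans (sym (*ₘ-·ᵥ C D v i)) (trans (·ᵥ-congˡ CD≈1 v i) (1ₘ-·ᵥ v i))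

    U⁻¹ = proj₁ U-invertible
    V⁻¹ = proj₁ V-invertible

  module _ (M : ℕ) where

    private
      ∣S⇒∣B : ∀ v → (∀ i → ℤ.+ M ∣ₛ (S ·ᵥ v) i) → ∀ i → ℤ.+ M ∣ₛ (B ·ᵥ V ·ᵥ v) i
      ∣S⇒∣B v M∣ i = subst (ℤ.+ M ∣ₛ_) (cancel-inverse U⁻¹ U (proj₂ (proj₂ U-invertible)) (B ·ᵥ V ·ᵥ v) i)
        (∣-·ᵥ U⁻¹ (λ j → subst (ℤ.+ M ∣ₛ_) (sym (equivalent-·ᵥ v j)) (M∣ j)) i)

      ∣B⇒∣S : ∀ w → (∀ i → ℤ.+ M ∣ₛ (B ·ᵥ w) i) → ∀ i → ℤ.+ M ∣ₛ (S ·ᵥ V⁻¹ ·ᵥ w) i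
      ∣B⇒∣S w M∣ i = subst (ℤ.+ M ∣ₛ_)
        (trans (·ᵥ-congʳ U (·ᵥ-congʳ B (λ j → sym (cancel-inverse V V⁻¹ (proj₁ (proj₂ V-invertible)) w j))) i)
          (equivalent-·ᵥ (V⁻¹ ·ᵥ w) i))
        (∣-·ᵥ U M∣ i)

      P? : ∀ i → Dec (ℤ.+ M ∣ S i i)
      P? i = M ∣abs? S i i
      good : List (Fin k)
      good = filter P? (allFin k)
      a : ℕ
      a = length good
      count≡ : countMultiples M (diagonal S) ≡ a
      count≡ = trans (cong (countMultiples M)
          (trans (diagonal-square S) (sym (map-tabulate id (λ i → S i i)))))
        (length-filter-map (M ∣abs?_) (λ i → S i i) (allFin k))

    module _ (p : ℕ) (1<p : 1 < p) where

      -- Arbitrary integers at the positions where `M` divides the diagonal of `S`, with zeros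
      -- elsewhere, give v with S v ≡ 0 modulo M, so V v is in the kernel of `B` modulo `M`. If the
      -- coordinates chosen by `h` control divisibility by p on that kernel, they control it for v
      -- as well, since V is invertible.
      countMultiples-≤ : ∀ {b} (h : Fin b → Fin k) →
        (∀ F → (∀ i → ℤ.+ M ∣ₛ (B ·ᵥ F) i) → (∀ t → ℤ.+ p ∣ₛ F (h t)) → ∀ c → ℤ.+ p ∣ₛ F c) →
        countMultiples M (diagonal S) ≤ b
      countMultiples-≤ {b} h ker =
        subst (_≤ b) (sym count≡) (injective-mod-p⇒≤ 1<p T T-- T-ker)
        where
        extend : Vector ℤ a → Vector ℤ k
        extend x i with P? i
        ... | yes M∣Sii = x (index (∈-filter⁺ P? (∈-allFin i) M∣Sii))
        ... | no  _     = 0ℤ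

        extend-- : ∀ x y i → extend (λ u → x u ℤ.- y u) i ≡ extend x i ℤ.- extend y i
        extend-- x y i with P? i
        ... | yes _ = refl
        ... | no  _ = refl

        extend-good : ∀ x u → extend x (lookup good u) ≡ x u
        extend-good x u with P? (lookup good u)
        ... | yes M∣ = cong x (sym (lookup-injective (Unique.filter⁺ P? (Unique.allFin⁺ k)) u _
                         (lookup-index (∈-filter⁺ P? (∈-allFin (lookup good u)) M∣))))
        ... | no  M∤ = contradiction (proj₂ (∈-filter⁻ P? {xs = allFin k} (∈-lookup {xs = good} u))) M∤

        M∣S-extend : ∀ x i → ℤ.+ M ∣ₛ (S ·ᵥ extend x) i
        M∣S-extend x i = subst (ℤ.+ M ∣ₛ_) (sym (diagonal-·ᵥ isDiagonal (extend x) i)) M∣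
          where
          M∣ : ℤ.+ M ∣ₛ S i i ℤ.* extend x i
          M∣ with P? i
          ... | yes M∣Sii = ℤ∣.∣m⇒∣m*n {m = S i i} _ (∣ᵤ⇒∣ M∣Sii)
          ... | no  _     = ℤ∣.divides 0ℤ (ℤ.*-zeroʳ (S i i))

        T : Vector ℤ a → Vector ℤ b
        T x t = (V ·ᵥ extend x) (h t)

        T-- : ∀ x y t → T (λ u → x u ℤ.- y u) t ≡ T x t ℤ.- T y t
        T-- x y t = trans (·ᵥ-congʳ V (extend-- x y) (h t)) (·ᵥ-- V (extend x) (extend y) (h t))

        T-ker : ∀ x → (∀ t → ℤ.+ p ∣ₛ T x t) → ∀ u → ℤ.+ p ∣ₛ x u
        T-ker x p∣T u = subst (ℤ.+ p ∣ₛ_)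
          (trans (cancel-inverse V⁻¹ V (proj₂ (proj₂ V-invertible)) (extend x) (lookup good u)) (extend-good x u))
          (∣-·ᵥ V⁻¹ (ker (V ·ᵥ extend x) (∣S⇒∣B (extend x) (M∣S-extend x)) p∣T) (lookup good u))

      -- For each x the vector w = V⁻¹ (x ∘ h) satisfies S w ≡ 0 modulo M, so `cancel` makes w
      -- divisible by p wherever `M` does not divide the diagonal. Hence the remaining coordinates
      -- of w determine x modulo p; the section `s` reads x off V w.
      countMultiples-≥ : ∀ {b} (h : Fin k → Fin b) (s : Fin b → Fin k) → (∀ t → h (s t) ≡ t) →
        (∀ x y → ℤ.+ M ∣ₛ x ℤ.* y → ¬ ℤ.+ M ∣ₛ x → ℤ.+ p ∣ₛ y) →
        (∀ x i → ℤ.+ M ∣ₛ (B ·ᵥ (x ∘ h)) i) →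
        b ≤ countMultiples M (diagonal S)
      countMultiples-≥ {b} h s h∘s cancel M∣B =
        subst (b ≤_) (sym count≡) (injective-mod-p⇒≤ 1<p T T-- T-ker)
        where
        T : Vector ℤ b → Vector ℤ a
        T x u = (V⁻¹ ·ᵥ (x ∘ h)) (lookup good u)

        T-- : ∀ x y u → T (λ t → x t ℤ.- y t) u ≡ T x u ℤ.- T y u
        T-- x y u = ·ᵥ-- V⁻¹ (x ∘ h) (y ∘ h) (lookup good u)

        T-ker : ∀ x → (∀ u → ℤ.+ p ∣ₛ T x u) → ∀ t → ℤ.+ p ∣ₛ x t
        T-ker x p∣T t = subst (ℤ.+ p ∣ₛ_)
          (trans (cancel-inverse V V⁻¹ (proj₁ (proj₂ V-invertible)) (x ∘ h) (s t)) (cong x (h∘s t)))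
          (∣-·ᵥ V p∣z (s t))
          where
          p∣z : ∀ i → ℤ.+ p ∣ₛ (V⁻¹ ·ᵥ (x ∘ h)) i
          p∣z i with P? i
          ... | no  M∤ = cancel (S i i) _
            (subst (ℤ.+ M ∣ₛ_) (diagonal-·ᵥ isDiagonal (V⁻¹ ·ᵥ (x ∘ h)) i) (∣B⇒∣S (x ∘ h) (M∣B x) i))
            (M∤ ∘ ∣⇒∣ᵤ)
          ... | yes M∣ = subst (λ j → ℤ.+ p ∣ₛ (V⁻¹ ·ᵥ (x ∘ h)) j) (sym (lookup-index i∈)) (p∣T (index i∈))
            where i∈ = ∈-filter⁺ P? (∈-allFin i) M∣

-- The number of rows is made a variable so that its equation with `k` can be matched by `refl`; for
-- `A` both sides are compound terms.
countMultiples-≤ : ∀ {N k} → N ≡ k → (B S : Matrix N k) → IsSmithNormalForm B S → ∀ M p → 1 < p →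
  ∀ {b} (h : Fin b → Fin k) →
  (∀ F → (∀ i → ℤ.+ M ∣ₛ (B ·ᵥ F) i) → (∀ t → ℤ.+ p ∣ₛ F (h t)) → ∀ c → ℤ.+ p ∣ₛ F c) →
  countMultiples M (diagonal S) ≤ b
countMultiples-≤ refl = SmithCount.countMultiples-≤

countMultiples-≥ : ∀ {N k} → N ≡ k → (B S : Matrix N k) → IsSmithNormalForm B S → ∀ M p → 1 < p →
  ∀ {b} (h : Fin k → Fin b) (s : Fin b → Fin k) → (∀ t → h (s t) ≡ t) →
  (∀ x y → ℤ.+ M ∣ₛ x ℤ.* y → ¬ ℤ.+ M ∣ₛ x → ℤ.+ p ∣ₛ y) →
  (∀ x i → ℤ.+ M ∣ₛ (B ·ᵥ (x ∘ h)) i) →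
  b ≤ countMultiples M (diagonal S)
countMultiples-≥ refl = SmithCount.countMultiples-≥

prime⇒1< : ∀ {q} → Prime q → 1 < q
prime⇒1< {q} q-prime = nonTrivial⇒n>1 q {{prime⇒nonTrivial q-prime}}

-- Invariant factors for a single prime power

module SmithPrimePower (p″ : ℕ) (p-prime : Prime (2+ p″)) (α : ℕ)
  (S : Matrix (length (codomainBasis (2+ p″ ^ α))) (2+ p″ ^ α))
  (snf : IsSmithNormalForm (A (2+ p″ ^ α)) S) where

  open PrimePower p″ p-prime
  open Kernel p″ p-prime α

  private
    k : ℕ
    k = p ^ α

    1<p : 1 < p
    1<p = s≤s (s≤s z≤n)

    p^[α∸e]≤k : ∀ e → p ^ (α ∸ e) ≤ k
    p^[α∸e]≤k e = ^-monoʳ-≤ p (m∸n≤m α e)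

    A-·ᵥ : ∀ (F : ℕ → ℤ) v → (∀ c → v c ≡ F (toℕ c)) →
           ∀ i → (A k ·ᵥ v) i ≡ row F (lookup (codomainBasis k) i)
    A-·ᵥ F v v≗F i = Sum.sum-cong-≗ (λ c → cong (A k i c ℤ.*_) (v≗F c))

    -- The kernel lemmas speak of functions on ℕ; rows use only values below `k`, so the default 0
    -- is immaterial.
    extend : Vector ℤ k → ℕ → ℤ
    extend v c with c <? k
    ... | yes c<k = v (fromℕ< c<k)
    ... | no  _   = 0ℤ

    extend-toℕ : ∀ v c → v c ≡ extend v (toℕ c)
    extend-toℕ v c with toℕ c <? k
    ... | yes c<k = cong v (sym (fromℕ<-toℕ c c<k))
    ... | no  c≮k = contradiction (toℕ<n c) c≮k

    ∣A⇒∣row : ∀ {M} v → (∀ i → M ∣ₛ (A k ·ᵥ v) i) → ∀ {x} → x ∈ codomainBasis k → M ∣ₛ row (extend v) x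
    ∣A⇒∣row {M} v M∣ x∈ = subst (λ x → M ∣ₛ row (extend v) x) (sym (lookup-index x∈))
      (subst (M ∣ₛ_) (A-·ᵥ (extend v) v (extend-toℕ v) (index x∈)) (M∣ (index x∈)))

    count-≤ : ∀ M q → 1 < q → ∀ {b} (h : Fin b → Fin k) →
      (∀ v → (∀ {x} → x ∈ codomainBasis k → ℤ.+ M ∣ₛ row (extend v) x) → (∀ t → ℤ.+ q ∣ₛ v (h t)) →
        ∀ c → c < k → ℤ.+ q ∣ₛ extend v c) →
      countMultiples M (diagonal S) ≤ b
    count-≤ M q 1<q h ker = countMultiples-≤ (length-codomainBasis α) (A k) S snf M q 1<q h
      (λ v M∣ q∣h c → subst (ℤ.+ q ∣ₛ_) (sym (extend-toℕ v c)) (ker v (∣A⇒∣row v M∣) q∣h (toℕ c) (toℕ<n c)))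

    -- When the whole kernel vanishes modulo `q`, no test coordinates are needed, so the bound is 0.
    count≡0 : ∀ M q → 1 < q → (∀ j → j ≤ α → ∀ x → ℤ.+ M ∣ₛ ℤ.+ (p ^ j) ℤ.* x → ℤ.+ q ∣ₛ x) →
              countMultiples M (diagonal S) ≡ 0
    count≡0 M q 1<q cancel = n≤0⇒n≡0 (count-≤ M q 1<q {0} (λ ())
      (λ v M∣row _ → F≡0 (extend v) (ℤ.+ M) M∣row (ℤ.+ q) cancel))

    p^e∣p^jx⇒p∣x : ∀ {e j} → j < e → ∀ x → ℤ.+ (p ^ e) ∣ₛ ℤ.+ (p ^ j) ℤ.* x → ℤ.+ p ∣ₛ x
    p^e∣p^jx⇒p∣x {e} {j} j<e x p^e∣ with l , refl ← m≤n⇒∃[o]m+o≡n j<e =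
      ℤ∣.∣-trans (ℤ∣.∣m⇒∣m*n (ℤ.+ (p ^ l)) ℤ∣.∣-refl)
        (ℤ∣.*-cancelˡ-∣ (ℤ.+ (p ^ j)) {{m^n≢0 p j}} (subst (_∣ₛ ℤ.+ (p ^ j) ℤ.* x) p^e≡ p^e∣))
      where
      p^e≡ : ℤ.+ (p ^ (suc j + l)) ≡ ℤ.+ (p ^ j) ℤ.* (ℤ.+ p ℤ.* ℤ.+ (p ^ l))
      p^e≡ = begin
        ℤ.+ (p ^ (suc j + l))                     ≡⟨ cong (λ n → ℤ.+ (p ^ n)) (+-suc j l) ⟨
        ℤ.+ (p ^ (j + suc l))                     ≡⟨ cong (λ m → ℤ.+ m) (^-distribˡ-+-* p j (suc l)) ⟩
        ℤ.+ (p ^ j * (p * p ^ l))                 ≡⟨ ℤ.pos-* (p ^ j) (p * p ^ l) ⟩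
        ℤ.+ (p ^ j) ℤ.* ℤ.+ (p * p ^ l)           ≡⟨ cong (ℤ.+ (p ^ j) ℤ.*_) (ℤ.pos-* p (p ^ l)) ⟩
        ℤ.+ (p ^ j) ℤ.* (ℤ.+ p ℤ.* ℤ.+ (p ^ l))   ∎

    p^e∣xy⇒p∣y : ∀ e x y → ℤ.+ (p ^ e) ∣ₛ x ℤ.* y → ¬ ℤ.+ (p ^ e) ∣ₛ x → ℤ.+ p ∣ₛ y
    p^e∣xy⇒p∣y e x y p^e∣xy p^e∤x with p ∣? ∣ y ∣
    ... | yes p∣y = ∣ᵤ⇒∣ p∣y
    ... | no  p∤y = contradiction (∣ᵤ⇒∣ {i = x} (coprime-divisor (∤⇒p^-coprime e p∤y)
      (subst (p ^ e ∣ℕ_) (trans (ℤ.abs-* x y) (*-comm ∣ x ∣ ∣ y ∣)) (∣⇒∣ᵤ p^e∣xy)))) p^e∤x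

    ∣p^⇒≡p : ∀ {q} → Prime q → ∀ j → q ∣ℕ p ^ j → q ≡ p
    ∣p^⇒≡p q-prime j q∣p^j with ∣p^⇒≡p^ j q∣p^j
    ... | zero  , _ , refl = contradiction q-prime ¬prime[1]
    ... | suc i , _ , refl with prime⇒irreducible q-prime {p} (m∣m*n (p ^ i))
    ... | inj₂ p≡q = sym p≡q

  -- With s = α - e, the upper bound tests a kernel vector, p^s-periodic modulo p, on its first p^s
  -- entries. The lower bound extends p^s arbitrary integers periodically; there `h` is reduction
  -- modulo p^s and its section is the inclusion.
  countMultiples-p^ : ∀ e → e ≤ α → countMultiples (p ^ e) (diagonal S) ≡ p ^ (α ∸ e)
  countMultiples-p^ e e≤α = ≤-antisym upper lower
    where
    s = α ∸ e
    upper : countMultiples (p ^ e) (diagonal S) ≤ p ^ s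
    upper = count-≤ (p ^ e) p 1<p (λ t → inject≤ t (p^[α∸e]≤k e)) ker
      where
      ring : ∀ x y → x ℤ.- y ℤ.+ y ≡ x
      ring = solve-∀
      ker : ∀ v → (∀ {x} → x ∈ codomainBasis k → ℤ.+ (p ^ e) ∣ₛ row (extend v) x) →
            (∀ t → ℤ.+ p ∣ₛ v (inject≤ t (p^[α∸e]≤k e))) → ∀ c → c < k → ℤ.+ p ∣ₛ extend v c
      ker v p^e∣row p∣v c c<k = subst (ℤ.+ p ∣ₛ_) (ring (extend v c) (extend v (c %p^ s)))
        (ℤ∣.∣m∣n⇒∣m+n
          (F-periodic (extend v) (ℤ.+ (p ^ e)) p^e∣row (ℤ.+ p) e (m∸n+n≡m e≤α) (λ j → p^e∣p^jx⇒p∣x) c c<k)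
          (subst (ℤ.+ p ∣ₛ_)
            (trans (extend-toℕ v _) (cong (extend v) (trans (toℕ-inject≤ t _) (toℕ-fromℕ< (%p^-< c s)))))
            (p∣v t)))
        where t = fromℕ< (%p^-< c s)
    lower : p ^ s ≤ countMultiples (p ^ e) (diagonal S)
    lower = countMultiples-≥ (length-codomainBasis α) (A k) S snf (p ^ e) p 1<p
      (h ∘ toℕ) (λ t → inject≤ t (p^[α∸e]≤k e)) h-inject (p^e∣xy⇒p∣y e) p^e∣A
      where
      h : ℕ → Fin (p ^ s)
      h c = fromℕ< (%p^-< c s)
      h-inject : ∀ t → h (toℕ (inject≤ t (p^[α∸e]≤k e))) ≡ t
      h-inject t = toℕ-injective (trans (toℕ-fromℕ< (%p^-< _ s))
        (trans (cong (_%p^ s) (toℕ-inject≤ t _)) (m<n⇒m%n≡m {{m^n≢0 p s}} (toℕ<n t))))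
      p^e∣A : ∀ x i → ℤ.+ (p ^ e) ∣ₛ (A k ·ᵥ (x ∘ h ∘ toℕ)) i
      p^e∣A x i = subst (ℤ.+ (p ^ e) ∣ₛ_) (sym (A-·ᵥ (x ∘ h) (x ∘ h ∘ toℕ) (λ _ → refl) i))
        (p^e∣row (x ∘ h) s e (m∸n+n≡m e≤α)
          (λ c c′ eq → cong x (fromℕ<-cong _ _ eq (%p^-< c s) (%p^-< c′ s))) (∈-lookup i))

  countMultiples-p^1+α : countMultiples (p ^ suc α) (diagonal S) ≡ 0
  countMultiples-p^1+α = count≡0 (p ^ suc α) p 1<p (λ j j≤α → p^e∣p^jx⇒p∣x (s≤s j≤α))

  countMultiples-≢p : ∀ {q} → Prime q → q ≢ p → countMultiples q (diagonal S) ≡ 0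
  countMultiples-≢p {q} q-prime q≢p = count≡0 q q (prime⇒1< q-prime) cancel
    where
    cancel : ∀ j → j ≤ α → ∀ x → ℤ.+ q ∣ₛ ℤ.+ (p ^ j) ℤ.* x → ℤ.+ q ∣ₛ x
    cancel j _ x q∣ with euclidsLemma (p ^ j) ∣ x ∣ q-prime (subst (q ∣ℕ_) (ℤ.abs-* (ℤ.+ (p ^ j)) x) (∣⇒∣ᵤ q∣))
    ... | inj₁ q∣p^j = contradiction (∣p^⇒≡p q-prime j q∣p^j) q≢p
    ... | inj₂ q∣x   = ∣ᵤ⇒∣ q∣x

-- Exponents in lists and in Kronecker products

-- Searches downwards from a power known not to divide x; the existence of such a bound is what
-- excludes x = 0.
exponent-exists : ∀ q N x → ¬ ℤ.+ (q ^ N) ∣ x → ∃[ e ] IsExponentOf q x e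
exponent-exists q zero    x q^N∤x = contradiction (1∣ ∣ x ∣) q^N∤x
exponent-exists q (suc N) x q^N∤x with q ^ N ∣abs? x
... | yes q^N∣x  = N , q^N∣x , q^N∤x
... | no  q^N∤x′ = exponent-exists q N x q^N∤x′

exponent-list : ∀ q N {xs} → All (λ x → ¬ ℤ.+ (q ^ N) ∣ x) xs → ∃[ es ] Pointwise (IsExponentOf q) xs es
exponent-list q N []                 = [] , []
exponent-list q N {x ∷ _} (∤x ∷ ∤xs) =
  let (e , ex) = exponent-exists q N x ∤x
      (es , exs) = exponent-list q N ∤xs
  in e ∷ es , ex ∷ exs

countMultiples≡0⇒∤ : ∀ M xs → countMultiples M xs ≡ 0 → All (λ x → ¬ ℤ.+ M ∣ x) xs
countMultiples≡0⇒∤ M xs eq = All.tabulate (λ x∈ M∣x →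
  contradiction (∈-length (∈-filter⁺ (M ∣abs?_) x∈ M∣x)) (<-irrefl (sym eq)))

-- These counts mediate between divisibility and permutations: on exponents they are the counts of
-- multiples of q^e, and over all e they determine a list up to order.
countAtLeast : ℕ → List ℕ → ℕ
countAtLeast e es = length (filter (e ≤?_) es)

≤exponent⇒∣ : ∀ {q x a e} → IsExponentOf q x a → e ≤ a → ℤ.+ (q ^ e) ∣ x
≤exponent⇒∣ {q} (q^a∣x , _) e≤a = ∣-trans (^-monoʳ-∣ q e≤a) q^a∣x

∣⇒≤exponent : ∀ {q x a e} → IsExponentOf q x a → ℤ.+ (q ^ e) ∣ x → e ≤ a
∣⇒≤exponent {q} (_ , q^1+a∤x) q^e∣x = ≮⇒≥ (λ a<e → q^1+a∤x (∣-trans (^-monoʳ-∣ q a<e) q^e∣x))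

length-filter-Pointwise : ∀ {A B : Set} {R : A → B → Set} {P : A → Set} {Q : B → Set}
  (P? : Decidable P) (Q? : Decidable Q) → (∀ {x y} → R x y → P x → Q y) → (∀ {x y} → R x y → Q y → P x) →
  ∀ {xs ys} → Pointwise R xs ys → length (filter P? xs) ≡ length (filter Q? ys)
length-filter-Pointwise P? Q? to from []       = refl
length-filter-Pointwise P? Q? to from {x ∷ _} {y ∷ _} (r ∷ rs)
  with P? x | Q? y | length-filter-Pointwise P? Q? to from rs
... | yes _  | yes _  | eq = cong suc eq
... | no  _  | no  _  | eq = eq
... | yes px | no ¬qy | _  = contradiction (to r px) ¬qy
... | no ¬px | yes qy | _  = contradiction (from r qy) ¬px

countAtLeast-exponents : ∀ {q xs es} → Pointwise (IsExponentOf q) xs es →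
                         ∀ e → countAtLeast e es ≡ countMultiples (q ^ e) xs
countAtLeast-exponents {q} exs e = sym (length-filter-Pointwise ((q ^ e) ∣abs?_) (e ≤?_)
  (λ {x} → ∣⇒≤exponent {x = x}) (λ {x} → ≤exponent⇒∣ {x = x}) exs)

-- The cofactors of q^a and q^b are prime to q, and so is their product by Euclid's lemma.
exponent-* : ∀ {q x y a b} → Prime q → IsExponentOf q x a → IsExponentOf q y b → IsExponentOf q (x ℤ.* y) (a + b)
exponent-* {q} {x} {y} {a} {b} q-prime (divides u x≡ , q^1+a∤x) (divides v y≡ , q^1+b∤y) =
  divides (u * v) xy≡ , q^∤xy
  where
  instance _ = prime⇒nonZero q-prime
  xy≡ : ∣ x ℤ.* y ∣ ≡ u * v * q ^ (a + b)
  xy≡ = begin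
    ∣ x ℤ.* y ∣                 ≡⟨ ℤ.abs-* x y ⟩
    ∣ x ∣ * ∣ y ∣               ≡⟨ cong₂ _*_ x≡ y≡ ⟩
    (u * q ^ a) * (v * q ^ b)   ≡⟨ [m*n]*[o*p]≡[m*o]*[n*p] u (q ^ a) v (q ^ b) ⟩
    (u * v) * (q ^ a * q ^ b)   ≡⟨ cong (u * v *_) (^-distribˡ-+-* q a b) ⟨
    u * v * q ^ (a + b)         ∎
  q∤cofactor : ∀ z {w} c → ∣ z ∣ ≡ w * q ^ c → ¬ q ^ suc c ∣ℕ ∣ z ∣ → ¬ q ∣ℕ w
  q∤cofactor z c z≡ q^∤z q∣w = q^∤z (subst (q ^ suc c ∣ℕ_) (sym z≡) (*-monoˡ-∣ (q ^ c) q∣w))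
  q^∤xy : ¬ q ^ suc (a + b) ∣ℕ ∣ x ℤ.* y ∣
  q^∤xy q^∣xy with euclidsLemma u v q-prime
    (*-cancelʳ-∣ (q ^ (a + b)) {{m^n≢0 q (a + b)}} (subst (q ^ suc (a + b) ∣ℕ_) xy≡ q^∣xy))
  ... | inj₁ q∣u = q∤cofactor x a x≡ q^1+a∤x q∣u
  ... | inj₂ q∣v = q∤cofactor y b y≡ q^1+b∤y q∣v

module _ (e : ℕ) where

  countAtLeast-++ : ∀ xs ys → countAtLeast e (xs ++ ys) ≡ countAtLeast e xs + countAtLeast e ys
  countAtLeast-++ xs ys = trans (cong length (filter-++ (e ≤?_) xs ys)) (length-++ (filter (e ≤?_) xs))

  countAtLeast-∷ : ∀ x xs → countAtLeast e (x ∷ xs) ≡ countAtLeast e (x ∷ []) + countAtLeast e xs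
  countAtLeast-∷ x = countAtLeast-++ (x ∷ [])

  countAtLeast-replicate : ∀ n x → countAtLeast e (replicate n x) ≡ n * countAtLeast e (x ∷ [])
  countAtLeast-replicate zero    x = refl
  countAtLeast-replicate (suc n) x = trans (countAtLeast-∷ x (replicate n x))
    (cong (_+_ (countAtLeast e (x ∷ []))) (countAtLeast-replicate n x))

countAtLeast-≤ : ∀ {e x} → e ≤ x → countAtLeast e (x ∷ []) ≡ 1
countAtLeast-≤ {e} e≤x = cong length (filter-all (e ≤?_) (e≤x ∷ []))

countAtLeast-> : ∀ {e x} → x < e → countAtLeast e (x ∷ []) ≡ 0
countAtLeast-> {e} x<e = cong length (filter-none (e ≤?_) (<⇒≱ x<e ∷ []))

∉⇒countAtLeast≡ : ∀ {x} ys → x ∉ ys → countAtLeast x ys ≡ countAtLeast (suc x) ys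
∉⇒countAtLeast≡ []       _ = refl
∉⇒countAtLeast≡ {x} (y ∷ ys) x∉ = begin
  countAtLeast x (y ∷ ys)                                 ≡⟨ countAtLeast-∷ x y ys ⟩
  countAtLeast x (y ∷ []) + countAtLeast x ys             ≡⟨ cong₂ _+_ head (∉⇒countAtLeast≡ ys (x∉ ∘ there)) ⟩
  countAtLeast (suc x) (y ∷ []) + countAtLeast (suc x) ys ≡⟨ countAtLeast-∷ (suc x) y ys ⟨
  countAtLeast (suc x) (y ∷ ys)                           ∎
  where
  head : countAtLeast x (y ∷ []) ≡ countAtLeast (suc x) (y ∷ [])
  head with x ≤? y
  ... | yes x≤y = trans (countAtLeast-≤ x≤y) (sym (countAtLeast-≤ (≤∧≢⇒< x≤y (x∉ ∘ here))))
  ... | no  x≰y = trans (countAtLeast-> (≰⇒> x≰y)) (sym (countAtLeast-> (m<n⇒m<1+n (≰⇒> x≰y))))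

countAtLeast-antitone : ∀ x xs → countAtLeast (suc x) xs ≤ countAtLeast x xs
countAtLeast-antitone x []       = z≤n
countAtLeast-antitone x (y ∷ xs) =
  subst₂ _≤_ (sym (countAtLeast-∷ (suc x) y xs)) (sym (countAtLeast-∷ x y xs))
    (+-mono-≤ head (countAtLeast-antitone x xs))
  where
  head : countAtLeast (suc x) (y ∷ []) ≤ countAtLeast x (y ∷ [])
  head with suc x ≤? y
  ... | yes x<y = ≤-reflexive (trans (countAtLeast-≤ x<y) (sym (countAtLeast-≤ (<⇒≤ x<y))))
  ... | no  x≮y = subst (_≤ countAtLeast x (y ∷ [])) (sym (countAtLeast-> (≰⇒> x≮y))) z≤n

-- The multiplicity of x is the drop between the counts at x and x + 1. It is positive for a list
-- headed by x, so x also occurs in the other list and can be removed from both.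
countAtLeast⇒↭ : ∀ xs ys → (∀ e → countAtLeast e xs ≡ countAtLeast e ys) → xs ↭ ys
countAtLeast⇒↭ []       []       _  = ↭-refl
countAtLeast⇒↭ []       (y ∷ ys) eq
  with () ← trans (eq 0) (trans (countAtLeast-∷ 0 y ys) (cong (_+ countAtLeast 0 ys) (countAtLeast-≤ {0} {y} z≤n)))
countAtLeast⇒↭ (x ∷ xs) ys eq with x ∈? ys
... | no  x∉ys = contradiction step (<⇒≢ (s≤s (countAtLeast-antitone x xs)))
  where
  step : countAtLeast (suc x) xs ≡ suc (countAtLeast x xs)
  step = begin
    countAtLeast (suc x) xs                                  ≡⟨ cong (_+ countAtLeast (suc x) xs) (countAtLeast-> (n<1+n x)) ⟨
    countAtLeast (suc x) (x ∷ []) + countAtLeast (suc x) xs  ≡⟨ countAtLeast-∷ (suc x) x xs ⟨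
    countAtLeast (suc x) (x ∷ xs)                            ≡⟨ eq (suc x) ⟩
    countAtLeast (suc x) ys                                  ≡⟨ ∉⇒countAtLeast≡ ys x∉ys ⟨
    countAtLeast x ys                                        ≡⟨ eq x ⟨
    countAtLeast x (x ∷ xs)                                  ≡⟨ countAtLeast-∷ x x xs ⟩
    countAtLeast x (x ∷ []) + countAtLeast x xs              ≡⟨ cong (_+ countAtLeast x xs) (countAtLeast-≤ {x} ≤-refl) ⟩
    suc (countAtLeast x xs)                                  ∎
... | yes x∈ys with as , bs , refl ← ∈-∃++ x∈ys =
  ↭-trans (prep x (countAtLeast⇒↭ xs (as ++ bs) eq′)) (↭-sym (↭-shift x as bs))
  where
  eq′ : ∀ e → countAtLeast e xs ≡ countAtLeast e (as ++ bs)
  eq′ e = +-cancelˡ-≡ (countAtLeast e (x ∷ [])) _ _ (begin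
    countAtLeast e (x ∷ []) + countAtLeast e xs         ≡⟨ countAtLeast-∷ e x xs ⟨
    countAtLeast e (x ∷ xs)                             ≡⟨ eq e ⟩
    countAtLeast e (as ++ x ∷ bs)                       ≡⟨ ↭-length (filter-↭ (e ≤?_) (↭-shift x as bs)) ⟩
    countAtLeast e (x ∷ as ++ bs)                       ≡⟨ countAtLeast-∷ e x (as ++ bs) ⟩
    countAtLeast e (x ∷ []) + countAtLeast e (as ++ bs) ∎)

-- Diagonals of Kronecker products

products : List ℤ → List ℤ → List ℤ
products xs ys = concatMap (λ x → map (x ℤ.*_) ys) xs

sums : List ℕ → List ℕ → List ℕ
sums as bs = concatMap (λ a → map (_+_ a) bs) as

tabulate-++ : ∀ {A : Set} m {n} (f : Fin (m + n) → A) →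
              tabulate f ≡ tabulate (λ i → f (i ↑ˡ n)) ++ tabulate (λ j → f (m ↑ʳ j))
tabulate-++ zero    f = refl
tabulate-++ (suc m) f = cong (f zero ∷_) (tabulate-++ m (f ∘ suc))

tabulate-combine : ∀ {A : Set} k m (f : Fin (k * m) → A) →
                   tabulate f ≡ concat (tabulate {n = k} (λ i → tabulate {n = m} (λ j → f (combine i j))))
tabulate-combine zero    m f = refl
tabulate-combine (suc k) m f = trans (tabulate-++ m f)
  (cong (tabulate (λ i → f (i ↑ˡ (k * m))) ++_) (tabulate-combine k m (λ i → f (m ↑ʳ i))))

-- When both factors are square, row and column indices split by the same `remQuot`, so a diagonal
-- position of the product is a pair of diagonal positions.
diagonal-⊗ : ∀ {k l m n} → k ≡ l → m ≡ n → (X : Matrix k l) (Y : Matrix m n) →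
             diagonal (X ⊗ Y) ≡ products (diagonal X) (diagonal Y)
diagonal-⊗ {k} {m = m} refl refl X Y = begin
  diagonal (X ⊗ Y)
    ≡⟨ diagonal-square (X ⊗ Y) ⟩
  tabulate (λ i → (X ⊗ Y) i i)
    ≡⟨ tabulate-combine k m (λ i → (X ⊗ Y) i i) ⟩
  concat (tabulate {n = k} (λ i → tabulate {n = m} (λ j → (X ⊗ Y) (combine i j) (combine i j))))
    ≡⟨ cong concat (tabulate-cong (λ i → tabulate-cong (λ j →
         cong (λ (i , j) → X i i ℤ.* Y j j) (remQuot-combine {k} {m} i j)))) ⟩
  concat (tabulate (λ i → tabulate (λ j → X i i ℤ.* Y j j)))
    ≡⟨ cong concat (tabulate-cong (λ i → map-tabulate (λ j → Y j j) (X i i ℤ.*_))) ⟨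
  concat (tabulate (λ i → map (X i i ℤ.*_) (tabulate (λ j → Y j j))))
    ≡⟨ cong concat (map-tabulate (λ i → X i i) (λ x → map (x ℤ.*_) (tabulate (λ j → Y j j)))) ⟨
  products (tabulate (λ i → X i i)) (tabulate (λ j → Y j j))
    ≡⟨ cong₂ products (diagonal-square X) (diagonal-square Y) ⟨
  products (diagonal X) (diagonal Y)
    ∎

exponents-products : ∀ {q xs ys as bs} → Prime q →
  Pointwise (IsExponentOf q) xs as → Pointwise (IsExponentOf q) ys bs →
  Pointwise (IsExponentOf q) (products xs ys) (sums as bs)
exponents-products q-prime []         eys = []
exponents-products {q} {x ∷ _} {as = a ∷ _} q-prime (ex ∷ exs) eys =
  Pointwise.++⁺
    (Pointwise.map⁺ (x ℤ.*_) (_+_ a) (Pointwise.map (λ {y} {b} → exponent-* {q} {x} {y} {a} {b} q-prime ex) eys))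
    (exponents-products q-prime exs eys)

sums-zeroˡ : ∀ e n bs → countAtLeast e (sums (replicate n 0) bs) ≡ n * countAtLeast e bs
sums-zeroˡ e zero    bs = refl
sums-zeroˡ e (suc n) bs = trans (countAtLeast-++ e (map id bs) _)
  (cong₂ _+_ (cong (countAtLeast e) (map-id bs)) (sums-zeroˡ e n bs))

sums-zeroʳ : ∀ e n as → countAtLeast e (sums as (replicate n 0)) ≡ n * countAtLeast e as
sums-zeroʳ e n []       = sym (*-zeroʳ n)
sums-zeroʳ e n (a ∷ as) = begin
  countAtLeast e (map (_+_ a) (replicate n 0) ++ sums as (replicate n 0))
    ≡⟨ countAtLeast-++ e (map (_+_ a) (replicate n 0)) _ ⟩
  countAtLeast e (map (_+_ a) (replicate n 0)) + countAtLeast e (sums as (replicate n 0))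
    ≡⟨ cong₂ _+_
         (trans (cong (countAtLeast e) (trans (map-replicate (_+_ a) n 0)
                                              (cong (replicate n) (+-identityʳ a))))
                (countAtLeast-replicate e n a))
         (sums-zeroʳ e n as) ⟩
  n * countAtLeast e (a ∷ []) + n * countAtLeast e as
    ≡⟨ *-distribˡ-+ n (countAtLeast e (a ∷ [])) (countAtLeast e as) ⟨
  n * (countAtLeast e (a ∷ []) + countAtLeast e as)
    ≡⟨ cong (n *_) (countAtLeast-∷ e a as) ⟨
  n * countAtLeast e (a ∷ as)
    ∎

replicate-+ : ∀ {A : Set} m n {x : A} → replicate (m + n) x ≡ replicate m x ++ replicate n x
replicate-+ zero    n = refl
replicate-+ (suc m) n = cong (_ ∷_) (replicate-+ m n)

sums-zero : ∀ m n → sums (replicate m 0) (replicate n 0) ≡ replicate (m * n) 0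
sums-zero zero    n = refl
sums-zero (suc m) n = trans (cong₂ _++_ (map-id (replicate n 0)) (sums-zero m n))
  (sym (replicate-+ n (m * n)))

length-diagonal : ∀ {m n} → m ≡ n → (X : Matrix m n) → length (diagonal X) ≡ n
length-diagonal refl X = trans (cong length (diagonal-square X)) (length-tabulate (λ i → X i i))

∤⇒exponents-zero : ∀ {q xs} → All (λ x → ¬ + q ∣ x) xs → Pointwise (IsExponentOf q) xs (replicate (length xs) 0)
∤⇒exponents-zero         []                 = []
∤⇒exponents-zero {q} {x ∷ _} (q∤x ∷ q∤xs) =
  (1∣ ∣ x ∣ , subst (λ n → ¬ n ∣ℕ ∣ x ∣) (sym (*-identityʳ q)) q∤x) ∷ ∤⇒exponents-zero q∤xs

-- The number of exponents ≥ e among the invariant factors of A (p ^ α).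
profile : ℕ → ℕ → ℕ → ℕ
profile p α e with e ≤? α
... | yes _ = p ^ (α ∸ e)
... | no  _ = 0

profile-≤ : ∀ p {α e} → e ≤ α → profile p α e ≡ p ^ (α ∸ e)
profile-≤ p {α} {e} e≤α with e ≤? α
... | yes _   = refl
... | no  e≰α = contradiction e≤α e≰α

-- Exponents for one prime and their behaviour under the full product

A-square : ∀ {p} → Prime p → ∀ α → length (codomainBasis (p ^ α)) ≡ p ^ α
A-square {2+ p″} p-prime = PrimePower.length-codomainBasis p″ p-prime

exponents-profile : ∀ p α xs → (∀ e → e ≤ α → countMultiples (p ^ e) xs ≡ p ^ (α ∸ e)) →
  countMultiples (p ^ suc α) xs ≡ 0 →
  ∃[ es ] Pointwise (IsExponentOf p) xs es × (∀ e → countAtLeast e es ≡ profile p α e)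
exponents-profile p α xs count-≤ count-> =
  let es , exs = exponent-list p (suc α) ∤ in
  es , exs , λ e → trans (countAtLeast-exponents exs e) (count e)
  where
  ∤ : All (λ x → ¬ + (p ^ suc α) ∣ x) xs
  ∤ = countMultiples≡0⇒∤ (p ^ suc α) xs count->
  count : ∀ e → countMultiples (p ^ e) xs ≡ profile p α e
  count e with e ≤? α
  ... | yes e≤α = count-≤ e e≤α
  ... | no  e≰α = cong length (filter-none ((p ^ e) ∣abs?_)
    (All.map (λ ∤x p^e∣x → ∤x (∣-trans (^-monoʳ-∣ p (≰⇒> e≰α)) p^e∣x)) ∤))

smith-exponents : ∀ {p} → Prime p → ∀ α (S : Matrix (length (codomainBasis (p ^ α))) (p ^ α)) →
  IsSmithNormalForm (A (p ^ α)) S →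
  ∃[ es ] Pointwise (IsExponentOf p) (diagonal S) es × (∀ e → countAtLeast e es ≡ profile p α e)
smith-exponents {p@(2+ p″)} p-prime α S snf =
  exponents-profile p α (diagonal S) countMultiples-p^ countMultiples-p^1+α
  where open SmithPrimePower p″ p-prime α S snf

smith-exponents-≢ : ∀ {p q} → Prime p → Prime q → q ≢ p →
  ∀ α (S : Matrix (length (codomainBasis (p ^ α))) (p ^ α)) → IsSmithNormalForm (A (p ^ α)) S →
  Pointwise (IsExponentOf q) (diagonal S) (replicate (p ^ α) 0)
smith-exponents-≢ {2+ p″} {q} p-prime q-prime q≢p α S snf =
  subst (λ n → Pointwise (IsExponentOf q) (diagonal S) (replicate n 0))
    (length-diagonal (A-square p-prime α) S)
    (∤⇒exponents-zero (countMultiples≡0⇒∤ q (diagonal S)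
      (SmithPrimePower.countMultiples-≢p p″ p-prime α S snf q-prime q≢p)))

∏-cong : ∀ {r} {m n : Fin r → ℕ} → m ≗ n → ∏ m ≡ ∏ n
∏-cong {zero}  m≗n = refl
∏-cong {suc r} m≗n = cong₂ _*_ (m≗n zero) (∏-cong (m≗n ∘ suc))

∣-∏ : ∀ {r} (n : Fin r → ℕ) j → n j ∣ℕ ∏ n
∣-∏ n zero    = m∣m*n _
∣-∏ n (suc j) = ∣n⇒∣m*n (n zero) (∣-∏ (n ∘ suc) j)

module _ {q : ℕ} (q-prime : Prime q) where

  ⨂-exponents-zero : ∀ {r} {m n : Fin r → ℕ} (S : ∀ j → Matrix (m j) (n j)) → (∀ j → m j ≡ n j) →
    (∀ j → Pointwise (IsExponentOf q) (diagonal (S j)) (replicate (n j) 0)) →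
    Pointwise (IsExponentOf q) (diagonal (⨂ S)) (replicate (∏ n) 0)
  ⨂-exponents-zero {zero}  S m≡n exs = ∤⇒exponents-zero ((λ q∣1 → <-irrefl (sym (∣1⇒≡1 q∣1)) (prime⇒1< q-prime)) ∷ [])
  ⨂-exponents-zero {suc r} {m} {n} S m≡n exs =
    subst₂ (Pointwise (IsExponentOf q))
      (sym (diagonal-⊗ (m≡n zero) (∏-cong (m≡n ∘ suc)) (S zero) (⨂ (S ∘ suc))))
      (sums-zero (n zero) (∏ (n ∘ suc)))
      (exponents-products q-prime (exs zero) (⨂-exponents-zero (S ∘ suc) (m≡n ∘ suc) (exs ∘ suc)))

  -- The other factors contribute exponent 0, so each exponent of factor j recurs once per diagonal
  -- position of the rest, that is ∏ n / n j times. Multiplying by `n j` avoids the quotient.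
  ⨂-exponents : ∀ {r} {m n : Fin r → ℕ} (S : ∀ j → Matrix (m j) (n j)) → (∀ j → m j ≡ n j) →
    ∀ j es → Pointwise (IsExponentOf q) (diagonal (S j)) es →
    (∀ i → i ≢ j → Pointwise (IsExponentOf q) (diagonal (S i)) (replicate (n i) 0)) →
    ∃[ fs ] Pointwise (IsExponentOf q) (diagonal (⨂ S)) fs
          × (∀ e → countAtLeast e fs * n j ≡ ∏ n * countAtLeast e es)
  ⨂-exponents {suc r} {m} {n} S m≡n zero es exs others =
    sums es (replicate N 0) ,
    subst (λ ds → Pointwise (IsExponentOf q) ds _)
      (sym (diagonal-⊗ (m≡n zero) (∏-cong (m≡n ∘ suc)) (S zero) (⨂ (S ∘ suc))))
      (exponents-products q-prime exs
        (⨂-exponents-zero (S ∘ suc) (m≡n ∘ suc) (λ i → others (suc i) λ ()))) ,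
    λ e → begin
      countAtLeast e (sums es (replicate N 0)) * n zero ≡⟨ cong (_* n zero) (sums-zeroʳ e N es) ⟩
      N * countAtLeast e es * n zero                    ≡⟨ *-comm _ (n zero) ⟩
      n zero * (N * countAtLeast e es)                  ≡⟨ *-assoc (n zero) N _ ⟨
      n zero * N * countAtLeast e es                    ∎
    where N = ∏ (n ∘ suc)
  ⨂-exponents {suc r} {m} {n} S m≡n (suc j) es exs others
    with fs , fxs , count ← ⨂-exponents (S ∘ suc) (m≡n ∘ suc) j es exs
                              (λ i i≢j → others (suc i) (i≢j ∘ Fin.suc-injective)) =
    sums (replicate (n zero) 0) fs ,
    subst (λ ds → Pointwise (IsExponentOf q) ds _)
      (sym (diagonal-⊗ (m≡n zero) (∏-cong (m≡n ∘ suc)) (S zero) (⨂ (S ∘ suc))))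
      (exponents-products q-prime (others zero λ ()) fxs) ,
    λ e → begin
      countAtLeast e (sums (replicate (n zero) 0) fs) * n (suc j) ≡⟨ cong (_* n (suc j)) (sums-zeroˡ e (n zero) fs) ⟩
      n zero * countAtLeast e fs * n (suc j)                      ≡⟨ *-assoc (n zero) _ _ ⟩
      n zero * (countAtLeast e fs * n (suc j))                    ≡⟨ cong (n zero *_) (count e) ⟩
      n zero * (∏ (n ∘ suc) * countAtLeast e es)                  ≡⟨ *-assoc (n zero) _ _ ⟨
      n zero * ∏ (n ∘ suc) * countAtLeast e es                    ∎

-- The prescribed list of exponents

φ-prime-power : ∀ {p} → Prime p → ∀ i → p ^ i + φ (p ^ suc i) ≡ p ^ suc i
φ-prime-power {2+ p″} p-prime i = cong (_+_ (2+ p″ ^ i)) (PrimePower.φ-p^ p″ p-prime i)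

module _ {p : ℕ} (p-prime : Prime p) (α c : ℕ) where

  private
    block : ℕ → List ℕ
    block i = replicate (φ (p ^ i) * c) (α ∸ i)

    blocks : ℕ → List ℕ
    blocks I = concatMap block (upTo I)

    countAtLeast-blocks-suc : ∀ e I → countAtLeast e (blocks (suc I)) ≡
                              countAtLeast e (blocks I) + φ (p ^ I) * c * countAtLeast e (α ∸ I ∷ [])
    countAtLeast-blocks-suc e I = begin
      countAtLeast e (blocks (suc I))
        ≡⟨ cong (countAtLeast e ∘ concatMap block) (applyUpTo-∷ʳ id I) ⟨
      countAtLeast e (concatMap block (upTo I ++ I ∷ []))
        ≡⟨ cong (countAtLeast e) (concatMap-++ block (upTo I) (I ∷ [])) ⟩
      countAtLeast e (blocks I ++ block I ++ [])
        ≡⟨ countAtLeast-++ e (blocks I) (block I ++ []) ⟩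
      countAtLeast e (blocks I) + countAtLeast e (block I ++ [])
        ≡⟨ cong (_+_ (countAtLeast e (blocks I)))
             (trans (cong (countAtLeast e) (++-identityʳ (block I))) (countAtLeast-replicate e (φ (p ^ I) * c) (α ∸ I))) ⟩
      countAtLeast e (blocks I) + φ (p ^ I) * c * countAtLeast e (α ∸ I ∷ [])
        ∎

    countAtLeast-blocks-> : ∀ e I → α < e → countAtLeast e (blocks I) ≡ 0
    countAtLeast-blocks-> e zero    α<e = refl
    countAtLeast-blocks-> e (suc I) α<e = trans (countAtLeast-blocks-suc e I)
      (cong₂ _+_ (countAtLeast-blocks-> e I α<e)
        (trans (cong (φ (p ^ I) * c *_) (countAtLeast-> (≤-<-trans (m∸n≤m α I) α<e))) (*-zeroʳ (φ (p ^ I) * c))))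

    -- Block i counts when e ≤ α - i, that is i ≤ α - e; the totients φ(p^i) for i up to the smaller
    -- of I and α - e telescope to a power of p.
    countAtLeast-blocks : ∀ e I → e ≤ α → I ≤ α → countAtLeast e (blocks (suc I)) ≡ p ^ (I ⊓ (α ∸ e)) * c
    countAtLeast-blocks e zero    e≤α _ = begin
      countAtLeast e (blocks 1)                   ≡⟨ countAtLeast-blocks-suc e 0 ⟩
      1 * c * countAtLeast e (α ∷ [])             ≡⟨ cong (1 * c *_) (countAtLeast-≤ e≤α) ⟩
      1 * c * 1                                   ≡⟨ *-identityʳ (1 * c) ⟩
      1 * c                                       ∎
    countAtLeast-blocks e (suc I) e≤α I<α
      rewrite countAtLeast-blocks-suc e (suc I) | countAtLeast-blocks e I e≤α (<⇒≤ I<α)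
      with suc I ≤? α ∸ e
    ... | yes I< = begin
      p ^ (I ⊓ (α ∸ e)) * c + φ (p ^ suc I) * c * countAtLeast e (α ∸ suc I ∷ [])
        ≡⟨ cong₂ _+_ (cong (λ i → p ^ i * c) (m≤n⇒m⊓n≡m (<⇒≤ I<)))
             (trans (cong (φ (p ^ suc I) * c *_) (countAtLeast-≤ e≤α∸1+I)) (*-identityʳ _)) ⟩
      p ^ I * c + φ (p ^ suc I) * c
        ≡⟨ *-distribʳ-+ c (p ^ I) _ ⟨
      (p ^ I + φ (p ^ suc I)) * c
        ≡⟨ cong (_* c) (φ-prime-power p-prime I) ⟩
      p ^ suc I * c
        ≡⟨ cong (λ i → p ^ i * c) (m≤n⇒m⊓n≡m I<) ⟨
      p ^ (suc I ⊓ (α ∸ e)) * c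
        ∎
      where
      e≤α∸1+I : e ≤ α ∸ suc I
      e≤α∸1+I = subst (_≤ α ∸ suc I) (m∸[m∸n]≡n e≤α) (∸-monoʳ-≤ α I<)
    ... | no I≮ = begin
      p ^ (I ⊓ (α ∸ e)) * c + φ (p ^ suc I) * c * countAtLeast e (α ∸ suc I ∷ [])
        ≡⟨ cong₂ _+_ (cong (λ i → p ^ i * c) (m≥n⇒m⊓n≡n (≮⇒≥ I≮)))
             (trans (cong (φ (p ^ suc I) * c *_) (countAtLeast-> e>α∸1+I)) (*-zeroʳ (φ (p ^ suc I) * c))) ⟩
      p ^ (α ∸ e) * c + 0
        ≡⟨ +-identityʳ _ ⟩
      p ^ (α ∸ e) * c
        ≡⟨ cong (λ i → p ^ i * c) (m≥n⇒m⊓n≡n (m≤n⇒m≤1+n (≮⇒≥ I≮))) ⟨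
      p ^ (suc I ⊓ (α ∸ e)) * c
        ∎
      where
      e>α∸1+I : α ∸ suc I < e
      e>α∸1+I = subst (α ∸ suc I <_) (m∸[m∸n]≡n e≤α) (∸-monoʳ-< (≰⇒> I≮) I<α)

  countAtLeast-exponent-blocks : ∀ e → countAtLeast e (blocks (suc α)) ≡ profile p α e * c
  countAtLeast-exponent-blocks e with e ≤? α
  ... | yes e≤α = trans (countAtLeast-blocks e α e≤α ≤-refl) (cong (λ i → p ^ i * c) (m≥n⇒m⊓n≡n (m∸n≤m α e)))
  ... | no  e≰α = countAtLeast-blocks-> e (suc α) (≰⇒> e≰α)

  exponent-blocks-↘ : Linked _≥_ (blocks (suc α))
  exponent-blocks-↘ = AllPairs⇒Linked (AllPairs.concat⁺
    (All.map⁺ (All.universal (λ i → replicate-↘ (φ (p ^ i) * c)) (upTo (suc α))))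
    (AllPairs.map⁺ (AllPairs.applyUpTo⁺₁ id (suc α)
      (λ {i} {j} i<j _ → All.replicate⁺ (φ (p ^ i) * c) (All.replicate⁺ (φ (p ^ j) * c) (∸-monoʳ-≤ α (<⇒≤ i<j)))))))
    where
    replicate-↘ : ∀ n {x} → AllPairs _≥_ (replicate n x)
    replicate-↘ zero    = []
    replicate-↘ (suc n) = All.replicate⁺ n ≤-refl ∷ replicate-↘ n

exponents-zero⇒∤ : ∀ {q} xs n → Pointwise (IsExponentOf q) xs (replicate n 0) → ¬ Any (+ q ∣_) xs
exponents-zero⇒∤ {q} (x ∷ xs) (suc n) ((_ , q∤x) ∷ _) (here q∣x) = q∤x (subst (_∣ℕ ∣ x ∣) (sym (*-identityʳ q)) q∣x)
exponents-zero⇒∤ (x ∷ xs) (suc n) (_ ∷ exs) (there q∣) = exponents-zero⇒∤ xs n exs q∣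

countAtLeast>0⇒Any : ∀ {q xs es} → Pointwise (IsExponentOf q) xs es → 0 < countAtLeast 1 es → Any (+ q ∣_) xs
countAtLeast>0⇒Any {q} {x ∷ _} {suc e ∷ _} ((q^∣x , _) ∷ _)   _   = here (∣-trans (m∣m*n (q ^ e)) q^∣x)
countAtLeast>0⇒Any {q} {x ∷ _} {zero  ∷ _} (_          ∷ exs) pos = there (countAtLeast>0⇒Any exs pos)

theorem2p16 :
    (n : ℕ) → .{{NonZero n}} →
    (r : ℕ) (p α : Fin r → ℕ) →
    (p-prime : ∀ j → Prime (p j)) →
    Injective _≡_ _≡_ p →
    (∀ j → 0 < α j) →
    n ≡ ∏ (λ j → p j ^ α j) →
    (S : ∀ j → Matrix (length (codomainBasis (p j ^ α j))) (p j ^ α j)) →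
    (∀ j → IsSmithNormalForm (A (p j ^ α j)) (S j)) →
    (∀ q → (Prime q × Any (+ q ∣_) (diagonal (⨂ S))) ⇔ (∃[ j ] q ≡ p j))
    × (∀ j → ∃[ es ] Pointwise (IsExponentOf (p j)) (diagonal (⨂ S)) es
                   × IsDecreasingRearrangement es (exponents n (p j) (α j) {{prime⇒nonZero (p-prime j)}}))
theorem2p16 n r p α p-prime p-injective α>0 n≡ S snf = (λ q → mk⇔ (to q) (from q)) , second
  where
  k : Fin r → ℕ
  k j = p j ^ α j

  square : ∀ j → length (codomainBasis (k j)) ≡ k j
  square j = A-square (p-prime j) (α j)

  local : ∀ j → ∃[ es ] Pointwise (IsExponentOf (p j)) (diagonal (⨂ S)) es
                      × (∀ e → countAtLeast e es * k j ≡ n * profile (p j) (α j) e)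
  local j =
    let es , exs , count = smith-exponents (p-prime j) (α j) (S j) (snf j)
        fs , fxs , count′ = ⨂-exponents (p-prime j) S square j es exs
          (λ i i≢j → smith-exponents-≢ (p-prime i) (p-prime j) (i≢j ∘ sym ∘ p-injective) (α i) (S i) (snf i))
    in fs , fxs , λ e → trans (count′ e) (cong₂ _*_ (sym n≡) (count e))

  to : ∀ q → Prime q × Any (+ q ∣_) (diagonal (⨂ S)) → ∃[ j ] q ≡ p j
  to q (q-prime , q∣) with Fin.any? (λ j → q ≟ p j)
  ... | yes found = found
  ... | no  none  = contradiction q∣ (exponents-zero⇒∤ _ _ (⨂-exponents-zero q-prime S square
    (λ j → smith-exponents-≢ (p-prime j) q-prime (λ q≡p → none (j , q≡p)) (α j) (S j) (snf j))))

  from : ∀ q → ∃[ j ] q ≡ p j → Prime q × Any (+ q ∣_) (diagonal (⨂ S))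
  -- As α j is positive, the profile at exponent 1 is p^(α-1), so the count of entries divisible by
  -- `p j`, scaled by `k j`, cannot be 0.
  from q (j , refl) = p-prime j , countAtLeast>0⇒Any (proj₁ (proj₂ (local j))) (n≢0⇒n>0 λ count≡0 →
    <⇒≢ n*profile>0 (trans (cong (_* k j) (sym count≡0)) (proj₂ (proj₂ (local j)) 1)))
    where
    instance _ = prime⇒nonZero (p-prime j)
    n*profile>0 : 0 < n * profile (p j) (α j) 1
    n*profile>0 = subst (λ x → 0 < n * x) (sym (profile-≤ (p j) (α>0 j)))
      (*-mono-< (>-nonZero⁻¹ n) (m^n>0 (p j) (α j ∸ 1)))

  second : ∀ j → ∃[ es ] Pointwise (IsExponentOf (p j)) (diagonal (⨂ S)) es
                       × IsDecreasingRearrangement es (exponents n (p j) (α j) {{prime⇒nonZero (p-prime j)}})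
  second j with fs , fxs , count ← local j = fs , fxs , countAtLeast⇒↭ fs _ count≡ , exponent-blocks-↘ (p-prime j) (α j) c
    where
    instance
      _ = prime⇒nonZero (p-prime j)
      k≢0 = m^n≢0 (p j) (α j)
    c = n / k j
    k∣n : k j ∣ℕ n
    k∣n = subst (k j ∣ℕ_) (sym n≡) (∣-∏ k j)
    count≡ : ∀ e → countAtLeast e fs ≡ countAtLeast e (exponents n (p j) (α j))
    -- Both counts are compared after scaling by `k j`, where n = c * k j removes the division in
    -- `c`.
    count≡ e = *-cancelʳ-≡ _ _ (k j) (begin
      countAtLeast e fs * k j                             ≡⟨ count e ⟩
      n * profile (p j) (α j) e                           ≡⟨ cong (_* profile (p j) (α j) e) (m/n*n≡m k∣n) ⟨
      c * k j * profile (p j) (α j) e                     ≡⟨ *-comm (c * k j) _ ⟩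
      profile (p j) (α j) e * (c * k j)                   ≡⟨ *-assoc (profile (p j) (α j) e) c (k j) ⟨
      profile (p j) (α j) e * c * k j                     ≡⟨ cong (_* k j) (countAtLeast-exponent-blocks (p-prime j) (α j) c e) ⟨
      countAtLeast e (exponents n (p j) (α j)) * k j      ∎)
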